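{- Let $(V,K)$ be a complete graph and $\mathcal{M}$ a 1-extendable $d$-dimensional abstract rigidity matroid on $K$. Then every $d(d+1)$-connected subgraph $(U,E)$ of $(V,K)$ is $\mathcal{M}$-rigid.
   Context: For $F\subseteq K$, $V(F)$ is the set of endpoints of edges in $F$, and $K(W)$ is the edge set of the complete graph on $W$. A matroid $\mathcal{M}$ on $K$ with closure operator $\langle\cdot\rangle$ is a $d$-dimensional abstract rigidity matroid if: (1) for $E,F\subseteq K$ with $|V(E)\cap V(F)|<d$, $\langle E\cup F\rangle\subseteq K(V(E))\cup K(V(F))$; and (2) if $E,F\subseteq K$ are $\mathcal{M}$-rigid and $|V(E)\cap V(F)|\ge d$, then $E\cup F$ is $\mathcal{M}$-rigid. Here $E\subseteq K$ is $\mathcal{M}$-rigid if $\langle E\rangle=K(V(E))$, and a subgraph $(U,E)$ is $\mathcal{M}$-rigid if $\langle E\rangle=K(U)$. A subgraph is $\mathcal{M}$-independent if its edge set is independent in $\mathcal{M}$. The $d$-dimensional 1-extension operation on an edge $v_1v_2$ and vertices $v_3,\dots,v_{d+1}$ deletes $v_1v_2$ and adds a new vertex $v$ with edges $vv_1,\dots,vv_{d+1}$. $\mathcal{M}$ is 1-extendable if the 1-extension operation (performed within $(V,K)$) preserves $\mathcal{M}$-independence. -}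

module Defs where

open import Data.Nat using (ℕ; zero; suc; _∸_) renaming (_<_ to _<ℕ_)
open import Data.Nat.Properties using (<-irrelevant)
open import Data.Fin using (Fin; toℕ) renaming (_≟_ to _≟F_)
open import Data.Bool using (Bool; true; false; _∧_; _∨_; not; if_then_else_)
open import Data.Product using (Σ; ∃; _×_; _,_)
open import Data.Sum using (_⊎_)
open import Data.Empty using (⊥)
open import Relation.Nullary using (¬_; Dec; yes; no)
open import Relation.Nullary.Decidable using (⌊_⌋)
open import Relation.Binary.PropositionalEquality using (_≡_; _≢_; refl; cong)
open import Function.Definitions using (Injective)
open import Function.Bundles using (_⇔_)

-- The complete graph (V,K) with V = Fin n.
-- An edge of K is an unordered pair {lo,hi} of distinct vertices,
-- represented canonically with lo < hi.

record Edge (n : ℕ) : Set where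
  constructor edge
  field
    lo    : Fin n
    hi    : Fin n
    lo<hi : toℕ lo <ℕ toℕ hi
open Edge public

_≟E_ : ∀ {n} (e f : Edge n) → Dec (e ≡ f)
edge a b p ≟E edge c d q with a ≟F c | b ≟F d
... | no a≢c | _ = no λ { refl → a≢c refl }
... | yes refl | no b≢d = no λ { refl → b≢d refl }
... | yes refl | yes refl with <-irrelevant p q
... | refl = yes refl

VSet : ℕ → Set
VSet n = Fin n → Bool

ESet : ℕ → Set
ESet n = Edge n → Bool

_∈E_ : ∀ {n} → Edge n → ESet n → Set
e ∈E X = X e ≡ true

_⊆E_ : ∀ {n} → ESet n → ESet n → Set
X ⊆E Y = ∀ e → e ∈E X → e ∈E Y

_∪E_ : ∀ {n} → ESet n → ESet n → ESet n
(X ∪E Y) e = X e ∨ Y e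

insertE : ∀ {n} → ESet n → Edge n → ESet n
insertE X f e = X e ∨ ⌊ e ≟E f ⌋

removeE : ∀ {n} → ESet n → Edge n → ESet n
removeE X f e = X e ∧ not ⌊ e ≟E f ⌋

Joins : ∀ {n} → Edge n → Fin n → Fin n → Set
Joins e u v = (lo e ≡ u × hi e ≡ v) ⊎ (lo e ≡ v × hi e ≡ u)

Incident : ∀ {n} → Fin n → Edge n → Set
Incident u e = (lo e ≡ u) ⊎ (hi e ≡ u)

VE : ∀ {n} → ESet n → Fin n → Set
VE F u = ∃ λ e → e ∈E F × Incident u e

InK : ∀ {n} → (Fin n → Set) → Edge n → Set
InK W e = W (lo e) × W (hi e)

AtLeast : ∀ {n} → ℕ → (Fin n → Set) → Set
AtLeast {n} k P = Σ (Fin k → Fin n) λ f → Injective _≡_ _≡_ f × (∀ i → P (f i))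

InV : ∀ {n} → VSet n → Fin n → Set
InV U u = U u ≡ true

record Matroid (n : ℕ) : Set where
  field
    cl      : ESet n → ESet n
    cl-cong : ∀ X Y → (∀ e → X e ≡ Y e) → ∀ e → cl X e ≡ cl Y e
    cl-incl : ∀ X → X ⊆E cl X
    cl-mono : ∀ X Y → X ⊆E Y → cl X ⊆E cl Y
    cl-idem : ∀ X → cl (cl X) ⊆E cl X
    cl-exch : ∀ X e f → cl X e ≡ false → cl (insertE X f) e ≡ true →
              cl (insertE X e) f ≡ true
open Matroid public

module _ {n : ℕ} (M : Matroid n) where

  Independent : ESet n → Set
  Independent X = ∀ e → e ∈E X → cl M (removeE X e) e ≡ false

  Rigid : ESet n → Set
  Rigid E = ∀ e → (e ∈E cl M E) ⇔ InK (VE E) e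

  RigidSub : VSet n → ESet n → Set
  RigidSub U E = ∀ e → (e ∈E cl M E) ⇔ InK (InV U) e

record IsAbstractRigidity {n : ℕ} (d : ℕ) (M : Matroid n) : Set where
  field
    ar1 : ∀ E F → ¬ AtLeast d (λ u → VE E u × VE F u) →
          ∀ e → e ∈E cl M (E ∪E F) → InK (VE E) e ⊎ InK (VE F) e
    ar2 : ∀ E F → Rigid M E → Rigid M F →
          AtLeast d (λ u → VE E u × VE F u) → Rigid M (E ∪E F)

-- M is 1-extendable: every d-dimensional 1-extension of an M-independent
-- edge set F (on the edge v₁v₂ ∈ F and vertices v₃,…,v_{d+1}, given by
-- `rest`, with v₁,…,v_{d+1} distinct, and a new vertex v ∉ V(F) different
-- from all vᵢ) is again M-independent.  F' is the result of the operation.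
OneExtendable : ∀ {n} (d : ℕ) → Matroid n → Set
OneExtendable {n} d M =
  ∀ (F F' : ESet n) (v₁ v₂ v : Fin n) (rest : Fin (d ∸ 1) → Fin n) →
  Independent M F →
  (∃ λ e → e ∈E F × Joins e v₁ v₂) →
  v₁ ≢ v₂ → Injective _≡_ _≡_ rest →
  (∀ i → rest i ≢ v₁) → (∀ i → rest i ≢ v₂) →
  ¬ VE F v → (∀ i → rest i ≢ v) →
  (∀ e → (e ∈E F') ⇔
           ((e ∈E F × ¬ Joins e v₁ v₂) ⊎ Joins e v v₁ ⊎ Joins e v v₂ ⊎
            (∃ λ i → Joins e v (rest i)))) →
  Independent M F'

Subgraph : ∀ {n} → VSet n → ESet n → Set
Subgraph U E = ∀ e → e ∈E E → InK (InV U) e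

data Reach {n : ℕ} (E : ESet n) (P : Fin n → Set) : Fin n → Fin n → Set where
  here : ∀ {u} → P u → Reach E P u u
  step : ∀ {u w v} (e : Edge n) → e ∈E E → Joins e u w → P u →
         Reach E P w v → Reach E P u v

KConnected : ∀ {n} → ℕ → VSet n → ESet n → Set
KConnected {n} k U E =
  AtLeast (suc k) (InV U) ×
  (∀ (S : VSet n) → ¬ AtLeast k (InV S) →
     ∀ u v → U u ≡ true → S u ≡ false → U v ≡ true → S v ≡ false →
     Reach E (λ w → U w ≡ true × S w ≡ false) u v)

{-# OPTIONS --safe #-}
module Submission where

-- Let G be the closure of E and D = d(d+1).  If N_S(u) is the neighbourhood of u in G[S], then u can be
-- added to an independent set of G[S - u] with min(d, |N_S(u)|) edges (0-extension, from the first axiom),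
-- or with d+1 edges if |N_S(u)| > d and N_S(u) is not a clique (1-extension).  Averaging over the deleted
-- vertex shows by induction on |S| that G[S] contains an independent set I with
--     2|I| + Σ_{u∈S} loss(N_S(u)) ≥ (2d+1)|S|,
-- where for k = |N| the loss is 2d+1-k if k ≤ d, and otherwise D/(k+1) + 1 if N is a clique and D/k if not.
-- The induction works because a d-clique in G together with two vertices adjacent to all of it forces
-- these two to be adjacent (second axiom), so at most one deletion turns a non-clique into a clique.
-- Let X be the set of vertices of U whose neighbourhood in G is not a clique.  By D-connectivity every
-- u ∈ X has a non-clique of at least D neighbours inside X, so all losses in G[X] are at most 1 and
-- |I| ≥ d|X|.  But K(X) is spanned by d(|X|-1) edges; hence X = ∅ and, by connectivity, G = K(U).

open import Defs
open import Data.Bool using (Bool; true; false; _∧_; _∨_; not; if_then_else_)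
open import Data.Bool.Properties using (∧-zeroʳ; ∧-identityʳ; ∧-assoc; ∧-comm) renaming (_≟_ to _≟B_)
open import Data.Empty using (⊥; ⊥-elim)
open import Data.Fin using (Fin; zero; suc; _≟_; toℕ; inject≤)
open import Data.Fin.Properties using (any?; suc-injective; toℕ-injective; injective⇒≤; inject≤-injective)
open import Data.List using (List; []; _∷_; _++_; length; tabulate)
open import Data.List.Membership.Propositional using (_∈_)
open import Data.List.Membership.Propositional.Properties using (∈-++⁺ˡ; ∈-++⁺ʳ; ∈-++⁻; ∈-tabulate⁺; ∈-tabulate⁻)
open import Data.List.Properties using (length-++; length-tabulate)
open import Data.List.Relation.Unary.All as All using ()
open import Data.List.Relation.Unary.AllPairs using ([]; _∷_)
open import Data.List.Relation.Unary.Any using (here; there)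
open import Data.List.Relation.Unary.Unique.Propositional using (Unique)
open import Data.List.Relation.Unary.Unique.Propositional.Properties using (Unique[x∷xs]⇒x∉xs) renaming (++⁺ to unique-++⁺; tabulate⁺ to unique-tabulate⁺)
open import Data.Nat using (ℕ; zero; suc; _+_; _*_; _∸_; _≤_; _<_; z≤n; s≤s; _≤?_; _!; _/_; >-nonZero)
open import Data.Nat.DivMod using (m*[n/m]≡n)
open import Data.Nat.Divisibility using (∣-trans; m∣m*n; m≤n⇒m!∣n!)
open import Data.Nat.Properties hiding (_≟_; suc-injective)
open import Data.Nat.Tactic.RingSolver using (solve-∀)
open import Data.Product using (Σ; ∃; ∃₂; _×_; _,_; proj₁; proj₂)
open import Data.Sum using (_⊎_; inj₁; inj₂)
open import Data.Unit using (⊤; tt)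
open import Function using (_∘_)
open import Function.Bundles using (mk⇔; Equivalence)
open import Function.Definitions using (Injective)
open import Relation.Binary.Definitions using (tri<; tri≈; tri>)
open import Relation.Binary.PropositionalEquality using (_≡_; _≢_; _≗_; refl; sym; trans; cong; cong₂; subst; module ≡-Reasoning)
open import Relation.Nullary using (¬_; Dec; yes; no)
open import Relation.Nullary.Decidable using (⌊_⌋; _×-dec_; ¬?)
open import Algebra.Properties.Semiring.Sum +-*-semiring using (sum; sum-cong-≗; ∑-distrib-+; ∑-comm; *-distribˡ-sum; *-distribʳ-sum)

-- Booleans and finite sums over vertex sets

∧-true⁻ : ∀ {x y} → x ∧ y ≡ true → x ≡ true × y ≡ true
∧-true⁻ {true} {true} _ = refl , refl

∧-true⁺ : ∀ {x y} → x ≡ true → y ≡ true → x ∧ y ≡ true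
∧-true⁺ refl refl = refl

true≢false : ∀ {x} → x ≡ true → x ≡ false → ⊥
true≢false refl ()

¬true⇒false : ∀ {x} → ¬ (x ≡ true) → x ≡ false
¬true⇒false {false} _ = refl
¬true⇒false {true} p = ⊥-elim (p refl)

⌊⌋-true⁻ : ∀ {P : Set} (P? : Dec P) → ⌊ P? ⌋ ≡ true → P
⌊⌋-true⁻ (yes p) _ = p

⌊⌋-true⁺ : ∀ {P : Set} (P? : Dec P) → P → ⌊ P? ⌋ ≡ true
⌊⌋-true⁺ (yes _) _ = refl
⌊⌋-true⁺ (no ¬p) p = ⊥-elim (¬p p)

⌊⌋-false⁺ : ∀ {P : Set} (P? : Dec P) → ¬ P → ⌊ P? ⌋ ≡ false
⌊⌋-false⁺ (yes p) ¬p = ⊥-elim (¬p p)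
⌊⌋-false⁺ (no _) _ = refl

sum-mono : ∀ {n} {f g : Fin n → ℕ} → (∀ i → f i ≤ g i) → sum f ≤ sum g
sum-mono {zero} _ = z≤n
sum-mono {suc n} f≤g = +-mono-≤ (f≤g zero) (sum-mono (f≤g ∘ suc))

⟦_⟧ : Bool → ℕ
⟦ true ⟧ = 1
⟦ false ⟧ = 0

⟦⟧-*-mono : ∀ b {x y} → (b ≡ true → x ≤ y) → ⟦ b ⟧ * x ≤ ⟦ b ⟧ * y
⟦⟧-*-mono false _ = z≤n
⟦⟧-*-mono true h = *-monoʳ-≤ 1 (h refl)

infixl 5 _∖_

_∖_ : ∀ {n} → VSet n → Fin n → VSet n
(S ∖ v) u = S u ∧ not ⌊ u ≟ v ⌋

∖-true⁻ : ∀ {n} (S : VSet n) v {u} → InV (S ∖ v) u → InV S u × u ≢ v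
∖-true⁻ S v {u} p with u ≟ v
... | yes _ = ⊥-elim (true≢false p (∧-zeroʳ (S u)))
... | no u≢v = proj₁ (∧-true⁻ p) , u≢v

∖-true⁺ : ∀ {n} (S : VSet n) v {u} → InV S u → u ≢ v → InV (S ∖ v) u
∖-true⁺ S v {u} p u≢v with u ≟ v
... | yes e = ⊥-elim (u≢v e)
... | no _ = ∧-true⁺ p refl

-- Indicator weights keep every sum over all of `Fin n`, so that double sums over varying sets can
-- be swapped by `∑-comm`.
∑∈ : ∀ {n} → VSet n → (Fin n → ℕ) → ℕ
∑∈ S f = sum (λ u → ⟦ S u ⟧ * f u)

count : ∀ {n} → VSet n → ℕ
count S = sum (⟦_⟧ ∘ S)

∑∈-mono : ∀ {n} (S : VSet n) {f g : Fin n → ℕ} → (∀ u → InV S u → f u ≤ g u) → ∑∈ S f ≤ ∑∈ S g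
∑∈-mono S h = sum-mono (λ u → ⟦⟧-*-mono (S u) (h u))

∑∈-cong : ∀ {n} (S : VSet n) {f g : Fin n → ℕ} → (∀ u → InV S u → f u ≡ g u) → ∑∈ S f ≡ ∑∈ S g
∑∈-cong S h = ≤-antisym (∑∈-mono S (λ u p → ≤-reflexive (h u p))) (∑∈-mono S (λ u p → ≤-reflexive (sym (h u p))))

∑∈-const : ∀ {n} (S : VSet n) c → ∑∈ S (λ _ → c) ≡ count S * c
∑∈-const S c = sym (*-distribʳ-sum c (⟦_⟧ ∘ S))

∑∈-+ : ∀ {n} (S : VSet n) (f g : Fin n → ℕ) → ∑∈ S (λ u → f u + g u) ≡ ∑∈ S f + ∑∈ S g
∑∈-+ S f g = trans (sum-cong-≗ (λ u → *-distribˡ-+ ⟦ S u ⟧ (f u) (g u))) (∑-distrib-+ (λ u → ⟦ S u ⟧ * f u) (λ u → ⟦ S u ⟧ * g u))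

count-cong : ∀ {n} {S S′ : VSet n} → S ≗ S′ → count S ≡ count S′
count-cong h = sum-cong-≗ (cong ⟦_⟧ ∘ h)

count-mono : ∀ {n} {S S′ : VSet n} → (∀ u → InV S u → InV S′ u) → count S ≤ count S′
count-mono {S = S} {S′} h = sum-mono λ u → lem (S u) (S′ u) (h u)
  where
  lem : ∀ a b → (a ≡ true → b ≡ true) → ⟦ a ⟧ ≤ ⟦ b ⟧
  lem false b _ = z≤n
  lem true b h rewrite h refl = ≤-refl

count≤n : ∀ {n} (S : VSet n) → count S ≤ n
count≤n {zero} S = z≤n
count≤n {suc n} S = +-mono-≤ (lem (S zero)) (count≤n (S ∘ suc))
  where
  lem : ∀ b → ⟦ b ⟧ ≤ 1
  lem true = ≤-refl
  lem false = z≤n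

∑∈-∖ : ∀ {n} (S : VSet n) (f : Fin n → ℕ) v → InV S v → ∑∈ S f ≡ f v + ∑∈ (S ∖ v) f
∑∈-∖ S f zero p rewrite p | *-identityˡ (f zero) =
  cong (f zero +_) (sum-cong-≗ (λ u → cong (λ b → ⟦ b ⟧ * f (suc u)) (sym (∧-identityʳ (S (suc u))))))
∑∈-∖ S f (suc v) p = begin
  ⟦ S zero ⟧ * f zero + ∑∈ (S ∘ suc) (f ∘ suc)
    ≡⟨ cong₂ _+_ (cong (λ b → ⟦ b ⟧ * f zero) (sym (∧-identityʳ (S zero)))) (∑∈-∖ (S ∘ suc) (f ∘ suc) v p) ⟩
  a + (f (suc v) + ∑∈ ((S ∘ suc) ∖ v) (f ∘ suc))
    ≡⟨ sym (+-assoc a _ _) ⟩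
  a + f (suc v) + ∑∈ ((S ∘ suc) ∖ v) (f ∘ suc)
    ≡⟨ cong (_+ ∑∈ ((S ∘ suc) ∖ v) (f ∘ suc)) (+-comm a _) ⟩
  f (suc v) + a + ∑∈ ((S ∘ suc) ∖ v) (f ∘ suc)
    ≡⟨ +-assoc (f (suc v)) _ _ ⟩
  f (suc v) + (a + ∑∈ ((S ∘ suc) ∖ v) (f ∘ suc))
    ≡⟨ cong (λ z → f (suc v) + (a + z)) (sum-cong-≗ (λ u → cong (λ b → ⟦ S (suc u) ∧ not b ⟧ * f (suc u)) (suc-≟ u))) ⟩
  f (suc v) + (a + ∑∈ (λ u → (S ∖ suc v) (suc u)) (f ∘ suc)) ∎
  where
  open ≡-Reasoning
  a = ⟦ S zero ∧ true ⟧ * f zero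
  suc-≟ : ∀ u → ⌊ u ≟ v ⌋ ≡ ⌊ suc u ≟ suc v ⌋
  suc-≟ u with u ≟ v
  ... | yes _ = refl
  ... | no _ = refl

count-∖ : ∀ {n} (S : VSet n) v → InV S v → count S ≡ suc (count (S ∖ v))
count-∖ S v p = trans (sym (c1 S)) (trans (∑∈-∖ S (λ _ → 1) v p) (cong suc (c1 (S ∖ v))))
  where
  c1 : ∀ S → ∑∈ S (λ _ → 1) ≡ count S
  c1 S = trans (∑∈-const S 1) (*-identityʳ _)

count-∖-suc : ∀ {n} (S : VSet n) v {k} → InV S v → count S ≡ suc k → count (S ∖ v) ≡ k
count-∖-suc S v p eq = cong (_∸ 1) (trans (sym (count-∖ S v p)) eq)

nonempty : ∀ {n} (S : VSet n) → 1 ≤ count S → ∃ (InV S)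
nonempty {zero} S ()
nonempty {suc n} S p with S zero in eq
... | true = zero , eq
... | false = let u , q = nonempty (S ∘ suc) p in suc u , q

empty : ∀ {n} (S : VSet n) → count S ≡ 0 → ∀ u → ¬ InV S u
empty S c u p with () ← trans (sym c) (count-∖ S u p)

-- Otherwise `g u + 1 ≤ f u` throughout `S`, and summing makes `∑∈ S f` exceed `∑∈ S g` by at least
-- `count S`. This averaging principle later selects the vertex to delete.
∑∈-pigeonhole : ∀ {n} (S : VSet n) (f g : Fin n → ℕ) → 1 ≤ count S → ∑∈ S f ≤ ∑∈ S g →
                ∃ λ u → InV S u × f u ≤ g u
∑∈-pigeonhole S f g ne h with any? (λ u → dec u)
  where
  dec : ∀ u → Dec (InV S u × f u ≤ g u)
  dec u with S u ≟B true | f u ≤? g u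
  ... | yes p | yes q = yes (p , q)
  ... | no ¬p | _ = no (¬p ∘ proj₁)
  ... | yes _ | no ¬q = no (¬q ∘ proj₂)
... | yes r = r
... | no none = ⊥-elim (<-irrefl refl (≤-trans (begin-strict
      ∑∈ S g                             <⟨ +-monoˡ-≤ (∑∈ S g) ne ⟩
      count S + ∑∈ S g                   ≡⟨ cong (_+ ∑∈ S g) (sym (trans (∑∈-const S 1) (*-identityʳ _))) ⟩
      ∑∈ S (λ _ → 1) + ∑∈ S g            ≡⟨ sym (∑∈-+ S (λ _ → 1) g) ⟩
      ∑∈ S (λ u → suc (g u))             ≤⟨ ∑∈-mono S (λ u p → ≰⇒> (λ q → none (u , p , q))) ⟩
      ∑∈ S f                             ∎) h))
  where open ≤-Reasoning

-- Enumerations, and `AtLeast` compared with `count`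

record Enumeration {n} (S : VSet n) (k : ℕ) : Set where
  field
    at       : Fin k → Fin n
    at-inj   : Injective _≡_ _≡_ at
    at-∈     : ∀ i → InV S (at i)
    at-surj  : ∀ u → InV S u → ∃ λ i → at i ≡ u

enumerate : ∀ {n} k (S : VSet n) → count S ≡ k → Enumeration S k
enumerate zero S c = record
  { at = λ () ; at-inj = λ { {()} } ; at-∈ = λ () ; at-surj = λ u p → ⊥-elim (empty S c u p) }
enumerate {n} (suc k) S c = record { at = at′ ; at-inj = inj ; at-∈ = mem ; at-surj = surj }
  where
  ne = nonempty S (≤-trans (s≤s z≤n) (≤-reflexive (sym c)))
  v = proj₁ ne
  open Enumeration (enumerate k (S ∖ v) (count-∖-suc S v (proj₂ ne) c))
  at′ : Fin (suc k) → Fin n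
  at′ zero = v
  at′ (suc i) = at i
  at≢v : ∀ i → at i ≢ v
  at≢v i = proj₂ (∖-true⁻ S v (at-∈ i))
  inj : Injective _≡_ _≡_ at′
  inj {zero} {zero} _ = refl
  inj {zero} {suc j} e = ⊥-elim (at≢v j (sym e))
  inj {suc i} {zero} e = ⊥-elim (at≢v i e)
  inj {suc i} {suc j} e = cong suc (at-inj e)
  mem : ∀ i → InV S (at′ i)
  mem zero = proj₂ ne
  mem (suc i) = proj₁ (∖-true⁻ S v (at-∈ i))
  surj : ∀ u → InV S u → ∃ λ i → at′ i ≡ u
  surj u p with u ≟ v
  ... | yes refl = zero , refl
  ... | no u≢v = let i , e = at-surj u (∖-true⁺ S v p u≢v) in suc i , e

AtLeast⇒count : ∀ {n} k (S : VSet n) → AtLeast k (InV S) → k ≤ count S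
AtLeast⇒count zero S _ = z≤n
AtLeast⇒count (suc k) S (f , inj , mem) rewrite count-∖ S (f zero) (mem zero) =
  s≤s (AtLeast⇒count k (S ∖ f zero)
    ( f ∘ suc , (λ e → suc-injective (inj e))
    , λ i → ∖-true⁺ S (f zero) (mem (suc i)) (λ e → zero≢suc (sym (inj e)))))
  where
  zero≢suc : ∀ {m} {i : Fin m} → Fin.zero ≢ suc i
  zero≢suc ()

count⇒AtLeast : ∀ {n} {k} (S : VSet n) → k ≤ count S → AtLeast k (InV S)
count⇒AtLeast S k≤ = at ∘ inj≤ , (λ e → inject≤-injective k≤ k≤ _ _ (at-inj e)) , (at-∈ ∘ inj≤)
  where
  open Enumeration (enumerate _ S refl)
  inj≤ = λ i → inject≤ i k≤

-- Edges, adjacency, edge lists and stars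

∨-true⁻ : ∀ {x y} → x ∨ y ≡ true → x ≡ true ⊎ y ≡ true
∨-true⁻ {true} _ = inj₁ refl
∨-true⁻ {false} p = inj₂ p

∨-true⁺ˡ : ∀ {x} y → x ≡ true → x ∨ y ≡ true
∨-true⁺ˡ _ refl = refl

∨-true⁺ʳ : ∀ x {y} → y ≡ true → x ∨ y ≡ true
∨-true⁺ʳ true _ = refl
∨-true⁺ʳ false p = p

module _ {n : ℕ} where

  Joins-sym : ∀ (e : Edge n) {u v} → Joins e u v → Joins e v u
  Joins-sym _ (inj₁ p) = inj₂ p
  Joins-sym _ (inj₂ p) = inj₁ p

  Joins-irrefl : ∀ (e : Edge n) {u} → ¬ Joins e u u
  Joins-irrefl (edge _ _ p) (inj₁ (refl , refl)) = <-irrefl refl p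
  Joins-irrefl (edge _ _ p) (inj₂ (refl , refl)) = <-irrefl refl p

  Joins-unique : ∀ (e f : Edge n) {u v} → Joins e u v → Joins f u v → e ≡ f
  Joins-unique (edge a b p) (edge _ _ q) (inj₁ (refl , refl)) (inj₁ (refl , refl)) = cong (edge a b) (<-irrelevant p q)
  Joins-unique (edge a b p) (edge _ _ q) (inj₂ (refl , refl)) (inj₂ (refl , refl)) = cong (edge a b) (<-irrelevant p q)
  Joins-unique (edge _ _ p) (edge _ _ q) (inj₁ (refl , refl)) (inj₂ (refl , refl)) = ⊥-elim (<-asym p q)
  Joins-unique (edge _ _ p) (edge _ _ q) (inj₂ (refl , refl)) (inj₁ (refl , refl)) = ⊥-elim (<-asym p q)

  Joins-end : ∀ (e : Edge n) {u x y} → Incident u e → Joins e x y → u ≡ x ⊎ u ≡ y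
  Joins-end _ (inj₁ refl) (inj₁ (p , _)) = inj₁ p
  Joins-end _ (inj₁ refl) (inj₂ (p , _)) = inj₂ p
  Joins-end _ (inj₂ refl) (inj₁ (_ , p)) = inj₂ p
  Joins-end _ (inj₂ refl) (inj₂ (_ , p)) = inj₁ p

  Joins⇒Incidentˡ : ∀ (e : Edge n) {u v} → Joins e u v → Incident u e
  Joins⇒Incidentˡ _ (inj₁ (p , _)) = inj₁ p
  Joins⇒Incidentˡ _ (inj₂ (_ , p)) = inj₂ p

  Joins⇒Incidentʳ : ∀ (e : Edge n) {u v} → Joins e u v → Incident v e
  Joins⇒Incidentʳ e j = Joins⇒Incidentˡ e (Joins-sym e j)

  Joins-lo-hi : ∀ (e : Edge n) → Joins e (lo e) (hi e)
  Joins-lo-hi _ = inj₁ (refl , refl)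

  lo≢hi : ∀ (e : Edge n) → lo e ≢ hi e
  lo≢hi (edge a _ p) refl = <-irrefl refl p

  InK-Joins⁻ : ∀ {P : Fin n → Set} (e : Edge n) {x y} → InK P e → Joins e x y → P x × P y
  InK-Joins⁻ _ (p , q) (inj₁ (refl , refl)) = p , q
  InK-Joins⁻ _ (p , q) (inj₂ (refl , refl)) = q , p

  InK-Joins⁺ : ∀ {P : Fin n → Set} (e : Edge n) {x y} → Joins e x y → P x → P y → InK P e
  InK-Joins⁺ _ (inj₁ (refl , refl)) p q = p , q
  InK-Joins⁺ _ (inj₂ (refl , refl)) p q = q , p

  abstract
    join : ∀ {u v : Fin n} → u ≢ v → Σ (Edge n) λ e → Joins e u v
    join {u} {v} u≢v with <-cmp (toℕ u) (toℕ v)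
    ... | tri< p _ _ = edge u v p , inj₁ (refl , refl)
    ... | tri≈ _ p _ = ⊥-elim (u≢v (toℕ-injective p))
    ... | tri> _ _ p = edge v u p , inj₂ (refl , refl)

    adj : ESet n → Fin n → Fin n → Bool
    adj H u v with u ≟ v
    ... | yes _ = false
    ... | no u≢v = H (proj₁ (join u≢v))

    adj⁻ : ∀ {H u v} → adj H u v ≡ true → ∃ λ e → e ∈E H × Joins e u v
    adj⁻ {H} {u} {v} p with u ≟ v
    ... | no u≢v = proj₁ (join u≢v) , p , proj₂ (join u≢v)

    adj⁺ : ∀ {H u v} e → e ∈E H → Joins e u v → adj H u v ≡ true
    adj⁺ {H} {u} {v} e p j with u ≟ v
    ... | yes refl = ⊥-elim (Joins-irrefl e j)
    ... | no u≢v = subst (_∈E H) (Joins-unique e (proj₁ (join u≢v)) j (proj₂ (join u≢v))) p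

  Adj : ESet n → Fin n → Fin n → Set
  Adj H u v = adj H u v ≡ true

  adj-edge⁻ : ∀ {H u v} e → Adj H u v → Joins e u v → e ∈E H
  adj-edge⁻ {H} e a j = let f , p , j′ = adj⁻ {H} a in subst (_∈E H) (Joins-unique f e j′ j) p

  Adj-sym : ∀ {H u v} → Adj H u v → Adj H v u
  Adj-sym {H} a = let e , p , j = adj⁻ {H} a in adj⁺ {H} e p (Joins-sym e j)

  Adj⇒≢ : ∀ {H u v} → Adj H u v → u ≢ v
  Adj⇒≢ {H} a refl = let e , p , j = adj⁻ {H} a in Joins-irrefl e j

  Adj-mono : ∀ {H H′ u v} → H ⊆E H′ → Adj H u v → Adj H′ u v
  Adj-mono {H} {H′} s a = let e , p , j = adj⁻ {H} a in adj⁺ {H′} e (s e p) j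

  ⟪_⟫ : List (Edge n) → ESet n
  ⟪ [] ⟫ _ = false
  ⟪ x ∷ l ⟫ = insertE ⟪ l ⟫ x

  ∈⇒⟪⟫ : ∀ {l e} → e ∈ l → e ∈E ⟪ l ⟫
  ∈⇒⟪⟫ {x ∷ l} {e} (here p) = ∨-true⁺ʳ (⟪ l ⟫ e) (⌊⌋-true⁺ (e ≟E x) p)
  ∈⇒⟪⟫ {x ∷ l} {e} (there p) = ∨-true⁺ˡ _ (∈⇒⟪⟫ p)

  ⟪⟫⇒∈ : ∀ l {e} → e ∈E ⟪ l ⟫ → e ∈ l
  ⟪⟫⇒∈ (x ∷ l) {e} p with ∨-true⁻ p
  ... | inj₁ q = there (⟪⟫⇒∈ l q)
  ... | inj₂ q = here (⌊⌋-true⁻ (e ≟E x) q)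

  ⟪⟫-mono : ∀ l l′ → (∀ {e} → e ∈ l → e ∈ l′) → ⟪ l ⟫ ⊆E ⟪ l′ ⟫
  ⟪⟫-mono l l′ h e p = ∈⇒⟪⟫ (h (⟪⟫⇒∈ l p))

  star : ∀ {m} v (f : Fin m → Fin n) → (∀ i → f i ≢ v) → List (Edge n)
  star v f f≢v = tabulate (λ i → proj₁ (join (f≢v i)))

  star-∈⁻ : ∀ {m} v (f : Fin m → Fin n) f≢v {e} → e ∈ star v f f≢v → ∃ λ i → Joins e v (f i)
  star-∈⁻ v f f≢v {e} p with ∈-tabulate⁻ p
  ... | i , refl = i , Joins-sym e (proj₂ (join (f≢v i)))

  star-∈⁺ : ∀ {m} v (f : Fin m → Fin n) f≢v {e} i → Joins e v (f i) → e ∈ star v f f≢v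
  star-∈⁺ v f f≢v {e} i j =
    subst (_∈ star v f f≢v) (Joins-unique (proj₁ (join (f≢v i))) e (proj₂ (join (f≢v i))) (Joins-sym e j)) (∈-tabulate⁺ i)

  star-unique : ∀ {m} v (f : Fin m → Fin n) f≢v → Injective _≡_ _≡_ f → Unique (star v f f≢v)
  star-unique v f f≢v inj = unique-tabulate⁺ λ {i} {j} eq →
    inj (same {i} {j} (Joins-end (proj₁ (join (f≢v j)))
      (subst (Incident (f i)) eq (Joins⇒Incidentˡ (proj₁ (join (f≢v i))) (proj₂ (join (f≢v i))))) (proj₂ (join (f≢v j)))))
    where
    same : ∀ {i j} → f i ≡ f j ⊎ f i ≡ v → f i ≡ f j
    same (inj₁ p) = p
    same {i} (inj₂ p) = ⊥-elim (f≢v i p)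

-- Independent lists and Steinitz exchange

module MatroidLists {n : ℕ} (M : Matroid n) where

  cl-⊆ : ∀ X Y → X ⊆E cl M Y → cl M X ⊆E cl M Y
  cl-⊆ X Y h e p = cl-idem M Y e (cl-mono M X (cl M Y) h e p)

  cl-false : ∀ X Y {e} → X ⊆E Y → cl M Y e ≡ false → cl M X e ≡ false
  cl-false X Y {e} s p = ¬true⇒false λ q → true≢false (cl-mono M X Y s e q) p

  -- A sequential form of independence, suited to sets grown edge by edge. It forces distinct
  -- entries, so `length` is the cardinality.
  IndepList : List (Edge n) → Set
  IndepList [] = ⊤
  IndepList (e ∷ l) = cl M ⟪ l ⟫ e ≡ false × IndepList l

  -- If some `f` in `X` fell into the closure of `X - f + e`, the exchange axiom over `X - f` would
  -- put `e` into the closure of `X`.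
  insert-independent : ∀ X e → Independent M X → cl M X e ≡ false → Independent M (insertE X e)
  insert-independent X e ind e∉ f f∈ with ∨-true⁻ {X f} f∈
  ... | inj₂ q with refl ← ⌊⌋-true⁻ (f ≟E e) q = cl-false _ X drop-e e∉
    where
    drop-e : removeE (insertE X e) e ⊆E X
    drop-e g p with ∧-true⁻ p
    ... | a , b with ∨-true⁻ {X g} a
    ... | inj₁ r = r
    ... | inj₂ r rewrite r with () ← b
  ... | inj₁ f∈X = ¬true⇒false λ f∈cl →
        true≢false (cl-mono M (insertE Y f) X back e
          (cl-exch M Y f e (ind f f∈X) (cl-mono M (removeE (insertE X e) f) (insertE Y e) fwd f f∈cl))) e∉
    where
    Y = removeE X f
    back : insertE Y f ⊆E X
    back g p with ∨-true⁻ {Y g} p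
    ... | inj₁ q = proj₁ (∧-true⁻ q)
    ... | inj₂ q with refl ← ⌊⌋-true⁻ (g ≟E f) q = f∈X
    fwd : removeE (insertE X e) f ⊆E insertE Y e
    fwd g p with ∧-true⁻ p
    ... | a , b with ∨-true⁻ {X g} a
    ... | inj₁ r = ∨-true⁺ˡ _ (∧-true⁺ r b)
    ... | inj₂ r = ∨-true⁺ʳ (Y g) r

  IndepList⇒Independent : ∀ l → IndepList l → Independent M ⟪ l ⟫
  IndepList⇒Independent [] _ _ ()
  IndepList⇒Independent (e ∷ l) (e∉ , ind) = insert-independent ⟪ l ⟫ e (IndepList⇒Independent l ind) e∉

  -- Since entries are distinct, taking `x` out of `⟪ x ∷ l ⟫` leaves all of `⟪ l ⟫`, and
  -- independence at `x` becomes the condition on the head.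
  Independent⇒IndepList : ∀ l → Unique l → Independent M ⟪ l ⟫ → IndepList l
  Independent⇒IndepList [] _ _ = tt
  Independent⇒IndepList (x ∷ l) uniq@(_ ∷ uniq′) ind =
    cl-false _ _ keep (ind x (∈⇒⟪⟫ {l = x ∷ l} (here refl))) ,
    Independent⇒IndepList l uniq′ λ e e∈ →
      cl-false _ _ (λ g p → let a , b = ∧-true⁻ {⟪ l ⟫ g} p in ∧-true⁺ {⟪ x ∷ l ⟫ g} (∨-true⁺ˡ _ a) b) (ind e (∨-true⁺ˡ _ e∈))
    where
    keep : ⟪ l ⟫ ⊆E removeE ⟪ x ∷ l ⟫ x
    keep g p = ∧-true⁺ {y = not ⌊ g ≟E x ⌋} (∨-true⁺ˡ _ p)
      (cong not (⌊⌋-false⁺ (g ≟E x) λ { refl → Unique[x∷xs]⇒x∉xs uniq (⟪⟫⇒∈ l p) }))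

  IndepList⇒Unique : ∀ l → IndepList l → Unique l
  IndepList⇒Unique [] _ = []
  IndepList⇒Unique (x ∷ l) (x∉ , ind) =
    All.tabulate (λ { {y} y∈ refl → true≢false (cl-incl M ⟪ l ⟫ x (∈⇒⟪⟫ y∈)) x∉ }) ∷ IndepList⇒Unique l ind

  -- Scanning l from the right, the first entry that brings e into the closure can be traded for e.
  exchange : ∀ I l e → cl M ⟪ I ⟫ e ≡ false → e ∈E cl M ⟪ l ++ I ⟫ →
             ∃ λ l′ → suc (length l′) ≡ length l × ⟪ l ++ I ⟫ ⊆E cl M ⟪ l′ ++ e ∷ I ⟫
  exchange I [] e e∉ e∈ = ⊥-elim (true≢false e∈ e∉)
  exchange I (b ∷ l) e e∉ e∈ with cl M ⟪ l ++ I ⟫ e in eq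
  ... | true = let l′ , len , sub = exchange I l e e∉ eq in b ∷ l′ , cong suc len , λ where
        g p → case′ g l′ sub (∨-true⁻ p)
    where
    case′ : ∀ g l′ → ⟪ l ++ I ⟫ ⊆E cl M ⟪ l′ ++ e ∷ I ⟫ → g ∈E ⟪ l ++ I ⟫ ⊎ ⌊ g ≟E b ⌋ ≡ true →
            g ∈E cl M ⟪ b ∷ l′ ++ e ∷ I ⟫
    case′ g l′ sub (inj₁ q) = cl-mono M ⟪ l′ ++ e ∷ I ⟫ ⟪ b ∷ l′ ++ e ∷ I ⟫ (λ _ → ∨-true⁺ˡ _) g (sub g q)
    case′ g l′ sub (inj₂ q) = cl-incl M ⟪ b ∷ l′ ++ e ∷ I ⟫ g (∨-true⁺ʳ _ q)
  ... | false = l , refl , λ g p → case′ g (∨-true⁻ p)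
    where
    move : insertE ⟪ l ++ I ⟫ e ⊆E ⟪ l ++ e ∷ I ⟫
    move g p with ∨-true⁻ {⟪ l ++ I ⟫ g} p
    ... | inj₂ q with refl ← ⌊⌋-true⁻ (g ≟E e) q = ∈⇒⟪⟫ (∈-++⁺ʳ l (here refl))
    ... | inj₁ q with ∈-++⁻ l (⟪⟫⇒∈ (l ++ I) q)
    ...   | inj₁ r = ∈⇒⟪⟫ (∈-++⁺ˡ r)
    ...   | inj₂ r = ∈⇒⟪⟫ (∈-++⁺ʳ l (there r))
    case′ : ∀ g → g ∈E ⟪ l ++ I ⟫ ⊎ ⌊ g ≟E b ⌋ ≡ true → g ∈E cl M ⟪ l ++ e ∷ I ⟫
    case′ g (inj₁ q) = cl-incl M ⟪ l ++ e ∷ I ⟫ g (move g (∨-true⁺ˡ _ q))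
    case′ g (inj₂ q) with refl ← ⌊⌋-true⁻ (g ≟E b) q =
      cl-mono M _ ⟪ l ++ e ∷ I ⟫ move b (cl-exch M ⟪ l ++ I ⟫ e b eq e∈)

  -- Entries of `B` are traded for those of `I` one at a time by `exchange`. What is left of `B`,
  -- together with the part of `I` already treated, keeps the length of `B` and still spans `B`.
  steinitz : ∀ I B → IndepList I → (∀ {e} → e ∈ I → e ∈E cl M ⟪ B ⟫) → length I ≤ length B
  steinitz I B ind sub = let l , len , _ = go I ind sub in ≤-trans (m≤n+m (length I) (length l)) (≤-reflexive len)
    where
    go : ∀ I → IndepList I → (∀ {e} → e ∈ I → e ∈E cl M ⟪ B ⟫) →
         ∃ λ l → length l + length I ≡ length B × ⟪ B ⟫ ⊆E cl M ⟪ l ++ I ⟫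
    go [] _ _ = B , +-identityʳ _ , λ e p → cl-incl M ⟪ B ++ [] ⟫ e (⟪⟫-mono B (B ++ []) ∈-++⁺ˡ e p)
    go (e ∷ I) (e∉ , ind) sub =
      let l , len , B⊆ = go I ind (sub ∘ there)
          l′ , len′ , l⊆ = exchange I l e e∉ (cl-⊆ ⟪ B ⟫ ⟪ l ++ I ⟫ B⊆ e (sub (here refl)))
      in l′ , trans (+-suc (length l′) (length I)) (trans (cong (_+ length I) len′) len)
            , λ g p → cl-⊆ ⟪ l ++ I ⟫ ⟪ l′ ++ e ∷ I ⟫ l⊆ g (B⊆ g p)

-- Consequences of the rigidity axioms

module Rigidity {n : ℕ} (c : ℕ) (M : Matroid n) (ar : IsAbstractRigidity (suc c) M) where

  open IsAbstractRigidity ar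
  open MatroidLists M

  d : ℕ
  d = suc c

  -- This is `ar1` with an empty second set: it has no endpoints, so the intersection has fewer than
  -- `d` vertices because `d` is positive.
  cl⊆K : ∀ X e → e ∈E cl M X → InK (VE X) e
  cl⊆K X e p with ar1 X (λ _ → false) (λ { (_ , _ , h) → noV (proj₂ (h zero)) }) e
                    (cl-mono M X _ (λ g → ∨-true⁺ˡ _) e p)
    where
    noV : ∀ {u} → ¬ VE (λ _ → false) u
    noV (_ , () , _)
  ... | inj₁ q = q
  ... | inj₂ ((_ , () , _) , _)

  K : VSet n → ESet n
  K W e = W (lo e) ∧ W (hi e)

  K-VE : ∀ W {u} → VE (K W) u → InV W u
  K-VE W (e , p , inj₁ refl) = proj₁ (∧-true⁻ p)
  K-VE W (e , p , inj₂ refl) = proj₂ (∧-true⁻ p)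

  K-rigid : ∀ W → Rigid M (K W)
  K-rigid W e = mk⇔ (cl⊆K (K W) e)
    λ (p , q) → cl-incl M (K W) e (∧-true⁺ (K-VE W p) (K-VE W q))

  -- The complete graphs on the `d`-clique plus `a` and on the `d`-clique plus `b` are rigid and
  -- share `d` vertices, so `ar2` makes their union rigid. The edge `ab` is then in the closure of a
  -- subset of the closed set `H`.
  glue : ∀ {H} → cl M H ⊆E H → (f : Fin d → Fin n) → Injective _≡_ _≡_ f →
         (∀ i j → f i ≢ f j → Adj H (f i) (f j)) →
         ∀ {a b} → (∀ i → Adj H (f i) a) → (∀ i → Adj H (f i) b) → a ≢ b → Adj H a b
  glue {H} closed f f-inj f-clique {a} {b} fa fb a≢b =
    adj⁺ {H = H} e (closed e (cl-mono M (A ∪E B) H A∪B⊆H e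
      (Equivalence.from (ar2 A B (K-rigid (W a)) (K-rigid (W b)) (f , f-inj , λ i → end fa i , end fb i) e)
        (InK-Joins⁺ {P = VE (A ∪E B)} e (proj₂ (join a≢b)) (inA (apex fa)) (inB (apex fb)))))) (proj₂ (join a≢b))
    where
    e = proj₁ (join a≢b)
    W : Fin n → VSet n
    W x u = ⌊ u ≟ x ⌋ ∨ ⌊ any? (λ i → u ≟ f i) ⌋
    A = K (W a)
    B = K (W b)
    W-apex : ∀ x → InV (W x) x
    W-apex x = ∨-true⁺ˡ _ (⌊⌋-true⁺ (x ≟ x) refl)
    W-f : ∀ x i → InV (W x) (f i)
    W-f x i = ∨-true⁺ʳ ⌊ f i ≟ x ⌋ (⌊⌋-true⁺ (any? (λ k → f i ≟ f k)) (i , refl))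
    spoke : ∀ {x} → (∀ i → Adj H (f i) x) → ∀ i → ∃ λ g → g ∈E K (W x) × Joins g (f i) x
    spoke {x} fx i = let g , _ , j = adj⁻ {H = H} (fx i)
                         p , q = InK-Joins⁺ {P = InV (W x)} g j (W-f x i) (W-apex x)
                     in g , ∧-true⁺ p q , j
    end : ∀ {x} → (∀ i → Adj H (f i) x) → ∀ i → VE (K (W x)) (f i)
    end fx i = let g , p , j = spoke fx i in g , p , Joins⇒Incidentˡ g j
    apex : ∀ {x} → (∀ i → Adj H (f i) x) → VE (K (W x)) x
    apex fx = let g , p , j = spoke fx zero in g , p , Joins⇒Incidentʳ g j
    inA : ∀ {u} → VE A u → VE (A ∪E B) u
    inA (g , p , i) = g , ∨-true⁺ˡ _ p , i
    inB : ∀ {u} → VE B u → VE (A ∪E B) u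
    inB (g , p , i) = g , ∨-true⁺ʳ (A g) p , i
    W⁻ : ∀ x {u} → InV (W x) u → u ≡ x ⊎ ∃ λ i → u ≡ f i
    W⁻ x {u} p with ∨-true⁻ {⌊ u ≟ x ⌋} p
    ... | inj₁ q = inj₁ (⌊⌋-true⁻ (u ≟ x) q)
    ... | inj₂ q = inj₂ (⌊⌋-true⁻ (any? (λ i → u ≟ f i)) q)
    W-Adj : ∀ {x} → (∀ i → Adj H (f i) x) → ∀ {u w} → u ≢ w → InV (W x) u → InV (W x) w → Adj H u w
    W-Adj {x} fx {u} {w} u≢w p q with W⁻ x {u} p | W⁻ x {w} q
    ... | inj₁ refl | inj₁ refl = ⊥-elim (u≢w refl)
    ... | inj₁ refl | inj₂ (i , refl) = Adj-sym {H = H} (fx i)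
    ... | inj₂ (i , refl) | inj₁ refl = fx i
    ... | inj₂ (i , refl) | inj₂ (j , refl) = f-clique i j u≢w
    K⊆H : ∀ {x} → (∀ i → Adj H (f i) x) → K (W x) ⊆E H
    K⊆H fx g p = let p₁ , p₂ = ∧-true⁻ p in
      adj-edge⁻ {H = H} g (W-Adj fx (lo≢hi g) p₁ p₂) (Joins-lo-hi g)
    A∪B⊆H : (A ∪E B) ⊆E H
    A∪B⊆H g p with ∨-true⁻ {A g} p
    ... | inj₁ q = K⊆H fa g q
    ... | inj₂ q = K⊆H fb g q

  -- The spokes are added one by one. The star of the spokes already present meets `l` in at most
  -- `m < d` vertices, so by `ar1` its closure with `l` only has edges inside one of the two vertex
  -- sets. The new spoke has an end `v` outside `l` and an end `f zero` outside the star.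
  zero-extension : ∀ {m} l v (f : Fin m → Fin n) f≢v → Injective _≡_ _≡_ f → m ≤ d →
                   IndepList l → ¬ VE ⟪ l ⟫ v → IndepList (star v f f≢v ++ l)
  zero-extension {zero} l v f f≢v inj m≤d ind v∉ = ind
  zero-extension {suc m} l v f f≢v inj m<d ind v∉ =
    ¬true⇒false e∉ ,
    zero-extension l v (f ∘ suc) (f≢v ∘ suc) (λ p → suc-injective (inj p)) (<⇒≤ m<d) ind v∉
    where
    s = star v (f ∘ suc) (f≢v ∘ suc)
    e = proj₁ (join (f≢v zero))
    j = proj₂ (join (f≢v zero))
    s-end : ∀ {u} → VE ⟪ s ⟫ u → u ≡ v ⊎ ∃ λ i → u ≡ f (suc i)
    s-end (g , p , inc) with star-∈⁻ v (f ∘ suc) (f≢v ∘ suc) (⟪⟫⇒∈ s p)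
    ... | i , jg with Joins-end g inc jg
    ... | inj₁ q = inj₁ q
    ... | inj₂ q = inj₂ (i , q)
    few : ¬ AtLeast d (λ u → VE ⟪ s ⟫ u × VE ⟪ l ⟫ u)
    -- No `h i` equals `v`, which is not an endpoint of `l`, so `idx` would inject `d` indices into
    -- `m < d`.
    few (h , h-inj , mem) = <⇒≱ m<d (injective⇒≤ {f = λ i → proj₁ (idx i)} λ {x} {y} eq →
        h-inj (trans (proj₂ (idx x)) (trans (cong (λ i → f (suc i)) eq) (sym (proj₂ (idx y))))))
      where
      idx : ∀ i → ∃ λ k → h i ≡ f (suc k)
      idx i with s-end (proj₁ (mem i))
      ... | inj₁ q = ⊥-elim (v∉ (subst (VE ⟪ l ⟫) q (proj₂ (mem i))))
      ... | inj₂ q = q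
    split : ⟪ s ++ l ⟫ ⊆E (⟪ s ⟫ ∪E ⟪ l ⟫)
    split g p with ∈-++⁻ s (⟪⟫⇒∈ (s ++ l) p)
    ... | inj₁ q = ∨-true⁺ˡ _ (∈⇒⟪⟫ q)
    ... | inj₂ q = ∨-true⁺ʳ (⟪ s ⟫ g) (∈⇒⟪⟫ q)
    e∉ : ¬ (e ∈E cl M ⟪ s ++ l ⟫)
    e∉ p with ar1 ⟪ s ⟫ ⟪ l ⟫ few e (cl-mono M ⟪ s ++ l ⟫ _ split e p)
    ... | inj₂ q = v∉ (proj₂ (InK-Joins⁻ {P = VE ⟪ l ⟫} e q j))
    ... | inj₁ q with s-end (proj₁ (InK-Joins⁻ {P = VE ⟪ s ⟫} e q j))
    ...   | inj₁ r = f≢v zero r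
    ...   | inj₂ (i , r) with () ← inj r

  -- Each vertex after the first is attached by at most `d` spokes. If it is joined to `d` vertices
  -- of a complete graph, `glue` supplies its remaining edges.
  spanning : ∀ m (S : VSet n) → count S ≡ m →
             ∃ λ l → length l ≤ d * (m ∸ 1) × (∀ {x y} → InV S x → InV S y → x ≢ y → Adj (cl M ⟪ l ⟫) x y)
  spanning zero S cS = [] , z≤n , λ {x} p → ⊥-elim (empty S cS x p)
  spanning (suc m) S cS = l′ , len′ , span′
    where
    ne = nonempty S (≤-trans (s≤s z≤n) (≤-reflexive (sym cS)))
    v = proj₁ ne
    S′ = S ∖ v
    cS′ : count S′ ≡ m
    cS′ = count-∖-suc S v (proj₂ ne) cS
    ih = spanning m S′ cS′
    l = proj₁ ih
    span : ∀ {x y} → InV S′ x → InV S′ y → x ≢ y → Adj (cl M ⟪ l ⟫) x y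
    span = proj₂ (proj₂ ih)
    open Enumeration (enumerate m S′ cS′)
    -- The new vertex is joined to all earlier vertices or to exactly `d` of them. For `m = 0` the
    -- bound `k ≤ d * m` forces `k = 0`, since the truncated `m ∸ 1` leaves no room for a spoke.
    Base : Set
    Base = ∃ λ k → k ≤ d × k ≤ d * m × Σ (Fin k → Fin n) λ f → (∀ i → InV S′ (f i)) ×
           ((∀ u → InV S′ u → ∃ λ i → f i ≡ u) ⊎ (k ≡ d × Injective _≡_ _≡_ f))
    base : Base
    base with m ≤? d
    ... | yes m≤d = m , m≤d , m≤m+n m (c * m) , at , at-∈ , inj₁ at-surj
    ... | no m≰d = d , ≤-refl , bound (<⇒≤ (≰⇒> m≰d)) , at ∘ ι , at-∈ ∘ ι ,
                   inj₂ (refl , λ eq → inject≤-injective d≤m d≤m _ _ (at-inj eq))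
      where
      d≤m = <⇒≤ (≰⇒> m≰d)
      ι = λ i → inject≤ i d≤m
      bound : ∀ {m} → d ≤ m → d ≤ d * m
      bound {suc m} _ = m≤m*n d (suc m)
    k = proj₁ base
    f = proj₁ (proj₂ (proj₂ (proj₂ base)))
    f∈ : ∀ i → InV S′ (f i)
    f∈ = proj₁ (proj₂ (proj₂ (proj₂ (proj₂ base))))
    f≢v : ∀ i → f i ≢ v
    f≢v i = proj₂ (∖-true⁻ S v (f∈ i))
    l′ = star v f f≢v ++ l
    len′ : length l′ ≤ d * m
    len′ = begin
      length l′                        ≡⟨ length-++ (star v f f≢v) ⟩
      length (star v f f≢v) + length l ≡⟨ cong (_+ length l) (length-tabulate (λ i → proj₁ (join (f≢v i)))) ⟩
      k + length l                     ≤⟨ bound m (proj₁ (proj₂ base)) (proj₁ (proj₂ (proj₂ base))) (proj₁ (proj₂ ih)) ⟩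
      d * m                            ∎
      where
      open ≤-Reasoning
      bound : ∀ m {k x} → k ≤ d → k ≤ d * m → x ≤ d * (m ∸ 1) → k + x ≤ d * m
      bound zero {k} {x} _ p q = subst (k + x ≤_) (trans (cong₂ _+_ (*-zeroʳ d) (*-zeroʳ d)) (sym (*-zeroʳ d))) (+-mono-≤ p q)
      bound (suc m) {k} {x} p _ q = subst (k + x ≤_) (sym (*-suc d m)) (+-mono-≤ p q)
    H = cl M ⟪ l′ ⟫
    old : ∀ {x y} → InV S′ x → InV S′ y → x ≢ y → Adj H x y
    old p q x≢y = Adj-mono {H = cl M ⟪ l ⟫} {H} (cl-mono M ⟪ l ⟫ ⟪ l′ ⟫ (⟪⟫-mono l l′ (∈-++⁺ʳ _))) (span p q x≢y)
    spoke : ∀ i → Adj H (f i) v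
    spoke i = adj⁺ {H = H} _ (cl-incl M ⟪ l′ ⟫ _ (∈⇒⟪⟫ (∈-++⁺ˡ (∈-tabulate⁺ i)))) (proj₂ (join (f≢v i)))
    new : ∀ x → InV S′ x → Adj H x v
    new x p with proj₂ (proj₂ (proj₂ (proj₂ (proj₂ base))))
    ... | inj₁ surj with i , refl ← surj x p = spoke i
    ... | inj₂ (eq , inj) with any? (λ i → f i ≟ x)
    ...   | yes (i , refl) = spoke i
    -- Here `x` is not a chosen neighbour, but `x` and `v` both see the whole `d`-clique `f`.
    ...   | no none = glue {H} (cl-idem M ⟪ l′ ⟫) (f ∘ cast) (λ e → cast-inj (inj e))
                        (λ i j → old (f∈ _) (f∈ _)) (λ i → old (f∈ _) p (λ e → none (_ , e)))
                        (λ i → spoke _) (proj₂ (∖-true⁻ S v p))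
      where
      cast : Fin d → Fin k
      cast = subst Fin (sym eq)
      cast-inj : ∀ {i j} → cast i ≡ cast j → i ≡ j
      cast-inj = subst-inj (sym eq)
        where
        subst-inj : ∀ {a b} (q : a ≡ b) {i j : Fin a} → subst Fin q i ≡ subst Fin q j → i ≡ j
        subst-inj refl e = e
    span′ : ∀ {x y} → InV S x → InV S y → x ≢ y → Adj H x y
    span′ {x} {y} p q x≢y with x ≟ v | y ≟ v
    ... | yes refl | yes refl = ⊥-elim (x≢y refl)
    ... | yes refl | no y≢v = Adj-sym {H = H} (new y (∖-true⁺ S v q y≢v))
    ... | no x≢v | yes refl = new x (∖-true⁺ S v p x≢v)
    ... | no x≢v | no y≢v = old (∖-true⁺ S v p x≢v) (∖-true⁺ S v q y≢v) x≢y

-- Cliques and neighbourhoods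

module Cliques {n : ℕ} (G : ESet n) where

  -- An explicit pair rather than the negation of `Clique`, because these two vertices span the edge
  -- that the 1-extension replaces.
  NonAdjacentPair : VSet n → Set
  NonAdjacentPair N = ∃₂ λ x y → InV N x × InV N y × x ≢ y × adj G x y ≡ false

  flawed? : ∀ N → Dec (NonAdjacentPair N)
  flawed? N = any? λ x → any? λ y → (N x ≟B true) ×-dec (N y ≟B true) ×-dec ¬? (x ≟ y) ×-dec (adj G x y ≟B false)

  Clique : VSet n → Set
  Clique N = ∀ {x y} → InV N x → InV N y → x ≢ y → Adj G x y

  ¬flawed⇒clique : ∀ {N} → ¬ NonAdjacentPair N → Clique N
  ¬flawed⇒clique h {x} {y} p q x≢y with adj G x y in eq
  ... | true = refl
  ... | false = ⊥-elim (h (x , y , p , q , x≢y , eq))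

  clique⇒¬flawed : ∀ {N} → Clique N → ¬ NonAdjacentPair N
  clique⇒¬flawed h (x , y , p , q , x≢y , eq) = true≢false (h p q x≢y) eq

  clique-∖ : ∀ {N} v → Clique N → Clique (N ∖ v)
  clique-∖ {N} v h p q = h (proj₁ (∖-true⁻ N v p)) (proj₁ (∖-true⁻ N v q))

  flawed-cong : ∀ {N N′} → N ≗ N′ → ⌊ flawed? N ⌋ ≡ ⌊ flawed? N′ ⌋
  flawed-cong {N} {N′} h with flawed? N | flawed? N′
  ... | yes _ | yes _ = refl
  ... | no _ | no _ = refl
  ... | yes (x , y , p , q , r) | no ¬b = ⊥-elim (¬b (x , y , trans (sym (h x)) p , trans (sym (h y)) q , r))
  ... | no ¬a | yes (x , y , p , q , r) = ⊥-elim (¬a (x , y , trans (h x) p , trans (h y) q , r))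

  N : VSet n → Fin n → VSet n
  N S u w = S w ∧ adj G u w

  -- The only fact about the matroid that enters the counting, isolated so that the loss can be
  -- studied for a bare graph.
  TwoDeletions : ℕ → Set
  TwoDeletions d = ∀ W {a b} → InV W a → InV W b → a ≢ b → suc (suc d) ≤ count W →
                   Clique (W ∖ a) → Clique (W ∖ b) → Clique W

  -- The loss of a neighbourhood and its local inequality

  module Loss (c L : ℕ) (q : ℕ → ℕ) (q-spec : ∀ m → suc m ≤ suc n → suc m * q (suc m) ≡ L)
              (two : TwoDeletions (suc c)) where

    d D : ℕ
    d = suc c
    D = d * suc d

    -- The flag says whether the neighbourhood, of size k, has a non-adjacent pair.  Up to the factor
    -- 2L this is d + 1/2 minus a lower bound for the expected rank increase caused by the vertex when
    -- vertices arrive in random order; L clears the denominators k and k + 1, with q m = L / m.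
    ℓ : ℕ → Bool → ℕ
    ℓ k b = if ⌊ k ≤? d ⌋ then (suc d + (d ∸ k)) * L else if b then D * q k else D * q (suc k) + L

    ℓ-small : ∀ {k} b → k ≤ d → ℓ k b ≡ (suc d + (d ∸ k)) * L
    ℓ-small {k} b p rewrite ⌊⌋-true⁺ (k ≤? d) p = refl

    ℓ-flawed : ∀ {k} → d < k → ℓ k true ≡ D * q k
    ℓ-flawed {k} p rewrite ⌊⌋-false⁺ (k ≤? d) (<⇒≱ p) = refl

    -- The first branch of `ℓ` and the clique formula agree at `k = d`: both give `(d + 1) * L`,
    -- because `D * q (d + 1) = d * L`.
    ℓ-clique : ∀ {k} → d ≤ k → k ≤ n → ℓ k false ≡ D * q (suc k) + L
    ℓ-clique {k} p k≤n with m≤n⇒m<n∨m≡n p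
    ... | inj₁ d<k rewrite ⌊⌋-false⁺ (k ≤? d) (<⇒≱ d<k) = refl
    ... | inj₂ refl = trans (ℓ-small false ≤-refl) (trans (cong (λ z → (suc d + z) * L) (n∸n≡0 d))
          (trans (lem d L) (trans (cong (λ z → d * z + L) (sym (q-spec d (s≤s k≤n)))) (cong (_+ L) (sym (*-assoc d (suc d) (q (suc d))))))))
      where
      lem : ∀ d L → (suc d + 0) * L ≡ d * L + L
      lem = solve-∀

    loss : VSet n → ℕ
    loss W = ℓ (count W) ⌊ flawed? W ⌋

    loss-cong : ∀ {W W′} → W ≗ W′ → loss W ≡ loss W′
    loss-cong h = cong₂ ℓ (count-cong h) (flawed-cong h)

    loss-clique : ∀ W {k} → count W ≡ k → d ≤ k → Clique W → loss W ≡ D * q (suc k) + L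
    loss-clique W refl d≤k cl = trans (cong (ℓ (count W)) (⌊⌋-false⁺ (flawed? W) (clique⇒¬flawed cl))) (ℓ-clique d≤k (count≤n W))

    loss-flawed : ∀ W {k} → count W ≡ k → d < k → NonAdjacentPair W → loss W ≡ D * q k
    loss-flawed W refl d<k fl = trans (cong (ℓ (count W)) (⌊⌋-true⁺ (flawed? W) fl)) (ℓ-flawed d<k)

    loss-small : ∀ W {k} → count W ≡ k → k ≤ d → loss W ≡ (suc d + (d ∸ k)) * L
    loss-small W refl k≤d = ℓ-small _ k≤d

    -- In units of `L` the loss is `2d + 1 - k`, and both sides equal `2d + 1 + k(2d + 2 - k)`.
    local-small : ∀ W k → count W ≡ k → k ≤ d →
      (2 * d + 1) * L + ∑∈ W (λ v → loss (W ∖ v)) ≤ 2 * k * L + suc k * loss W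
    local-small W zero eq _ = ≤-reflexive (begin
      (2 * d + 1) * L + ∑∈ W (λ v → loss (W ∖ v)) ≡⟨ cong ((2 * d + 1) * L +_) (∑∈-cong W (λ u p → ⊥-elim (empty W eq u p))) ⟩
      (2 * d + 1) * L + ∑∈ W (λ v → 0)            ≡⟨ cong ((2 * d + 1) * L +_) (trans (∑∈-const W 0) (*-zeroʳ (count W))) ⟩
      (2 * d + 1) * L + 0                         ≡⟨ lem d L ⟩
      1 * ((suc d + d) * L)                       ≡⟨ cong (1 *_) (sym (loss-small W eq z≤n)) ⟩
      1 * loss W                                  ∎)
      where
      open ≡-Reasoning
      lem : ∀ d L → (2 * d + 1) * L + 0 ≡ 1 * ((suc d + d) * L)
      lem = solve-∀
    local-small W (suc j) eq k≤d = ≤-reflexive (begin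
      (2 * d + 1) * L + ∑∈ W (λ v → loss (W ∖ v))
        ≡⟨ cong ((2 * d + 1) * L +_) (trans (∑∈-cong W (λ v p → loss-small (W ∖ v) (count-∖-suc W v p eq) (<⇒≤ k≤d))) (∑∈-const W _)) ⟩
      (2 * d + 1) * L + count W * ((suc d + (d ∸ j)) * L)
        ≡⟨ cong₂ (λ x y → (2 * d + 1) * L + x * ((suc d + y) * L)) eq d∸j ⟩
      (2 * d + 1) * L + suc j * ((suc d + suc t) * L)
        ≡⟨ subst (λ d → (2 * d + 1) * L + suc j * ((suc d + suc t) * L) ≡ 2 * suc j * L + suc (suc j) * ((suc d + t) * L)) (m+[n∸m]≡n k≤d) (lem j t L) ⟩
      2 * suc j * L + suc (suc j) * ((suc d + t) * L)
        ≡⟨ cong (λ x → 2 * suc j * L + suc (suc j) * x) (sym (loss-small W eq k≤d)) ⟩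
      2 * suc j * L + suc (suc j) * loss W ∎)
      where
      open ≡-Reasoning
      t = d ∸ suc j
      d∸j : d ∸ j ≡ suc t
      d∸j = +-∸-assoc 1 {d} {suc j} k≤d
      lem : ∀ j t L → (2 * (suc j + t) + 1) * L + suc j * ((suc (suc j + t) + suc t) * L)
                    ≡ 2 * suc j * L + suc (suc j) * ((suc (suc j + t) + t) * L)
      lem = solve-∀

    -- Every deletion leaves a clique, so with `k = j + 1` both sides equal `(2d + 1 + D + k) * L`.
    -- For `j = d` this uses that the clique formula is valid at size `d`.
    local-clique : ∀ W j → count W ≡ suc j → d ≤ j → Clique W →
      (2 * d + 1) * L + ∑∈ W (λ v → loss (W ∖ v)) ≤ 2 * d * L + suc (suc j) * loss W
    local-clique W j eq d≤j cl = ≤-reflexive (begin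
      (2 * d + 1) * L + ∑∈ W (λ v → loss (W ∖ v))
        ≡⟨ cong ((2 * d + 1) * L +_) (trans (∑∈-cong W (λ v p → loss-clique (W ∖ v) (count-∖-suc W v p eq) d≤j (clique-∖ v cl))) (∑∈-const W _)) ⟩
      (2 * d + 1) * L + count W * (D * q k + L)
        ≡⟨ cong (λ x → (2 * d + 1) * L + x * (D * q k + L)) eq ⟩
      (2 * d + 1) * L + k * (D * q k + L)
        ≡⟨ lem₁ d L k D (q k) ⟩
      2 * d * L + (D * (k * q k) + (L + k * L))
        ≡⟨ cong (λ x → 2 * d * L + (D * x + (L + k * L))) (trans (q-spec j (m≤n⇒m≤1+n k≤n)) (sym (q-spec k (s≤s k≤n)))) ⟩
      2 * d * L + (D * (suc k * q (suc k)) + (L + k * L))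
        ≡⟨ lem₂ d L k D (q (suc k)) ⟩
      2 * d * L + suc k * (D * q (suc k) + L)
        ≡⟨ cong (λ x → 2 * d * L + suc k * x) (sym (loss-clique W eq (m≤n⇒m≤1+n d≤j) cl)) ⟩
      2 * d * L + suc k * loss W ∎)
      where
      open ≡-Reasoning
      k = suc j
      k≤n : k ≤ n
      k≤n = subst (_≤ n) eq (count≤n W)
      lem₁ : ∀ d L k D x → (2 * d + 1) * L + k * (D * x + L) ≡ 2 * d * L + (D * (k * x) + (L + k * L))
      lem₁ = solve-∀
      lem₂ : ∀ d L k D x → 2 * d * L + (D * (suc k * x) + (L + k * L)) ≡ 2 * d * L + suc k * (D * x + L)
      lem₂ = solve-∀

    -- After multiplication by `j * (j + 1)` this reduces to `d(d + 1) ≤ j(j + 1)`.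
    q-step : ∀ {j} → d ≤ j → suc j ≤ n → D * q j ≤ D * q (suc j) + L
    q-step {suc i} d≤j k≤n = *-cancelˡ-≤ (k * j) (begin
      k * j * (D * q j)                ≡⟨ lem₁ k j D (q j) ⟩
      k * D * (j * q j)                ≡⟨ cong (k * D *_) (q-spec i (m≤n⇒m≤1+n (<⇒≤ k≤n))) ⟩
      (1 + j) * D * L                  ≡⟨ lem₂ j D L ⟩
      j * D * L + D * L                ≤⟨ +-monoʳ-≤ (j * D * L) (*-monoˡ-≤ L (≤-trans (*-mono-≤ d≤j (s≤s d≤j)) (≤-reflexive (*-comm j k)))) ⟩
      j * D * L + k * j * L            ≡⟨ cong (λ x → j * D * x + k * j * L) (sym (q-spec j (m≤n⇒m≤1+n k≤n))) ⟩
      j * D * (k * q k) + k * j * L    ≡⟨ lem₃ k j D (q k) L ⟩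
      k * j * (D * q k + L)            ∎)
      where
      open ≤-Reasoning
      j = suc i
      k = suc j
      lem₁ : ∀ k j D x → k * j * (D * x) ≡ k * D * (j * x)
      lem₁ = solve-∀
      lem₂ : ∀ j D L → (1 + j) * D * L ≡ j * D * L + D * L
      lem₂ = solve-∀
      lem₃ : ∀ k j D x L → j * D * (k * x) + k * j * L ≡ k * j * (D * x + L)
      lem₃ = solve-∀

    -- For `j = d` all deletions leave `d` vertices and equality holds. For `j > d` at most one
    -- deletion leaves a clique, by `two`. If one does, it contributes `D * q (suc j) + L` and the
    -- other `j` contribute `D * L` in total; if none does, the surplus `D * q j` is bounded by
    -- `q-step`.
    ∑-flawed : ∀ W j → count W ≡ suc j → d ≤ j → NonAdjacentPair W →
      ∑∈ W (λ v → loss (W ∖ v)) ≤ D * L + (D * q (suc j) + L)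
    ∑-flawed W j eq d≤j fl with m≤n⇒m<n∨m≡n d≤j
    ... | inj₂ refl = ≤-reflexive (begin
      ∑∈ W (λ v → loss (W ∖ v))
        ≡⟨ trans (∑∈-cong W (λ v p → loss-small (W ∖ v) (count-∖-suc W v p eq) ≤-refl)) (∑∈-const W _) ⟩
      count W * ((suc d + (d ∸ d)) * L) ≡⟨ cong₂ (λ x y → x * ((suc d + y) * L)) eq (n∸n≡0 d) ⟩
      suc d * ((suc d + 0) * L)         ≡⟨ lem₁ d L ⟩
      D * L + (d * L + L)               ≡⟨ cong (λ x → D * L + (d * x + L)) (sym (q-spec d (m≤n⇒m≤1+n (subst (_≤ n) eq (count≤n W))))) ⟩
      D * L + (d * (suc d * q (suc d)) + L) ≡⟨ cong (λ x → D * L + (x + L)) (sym (*-assoc d (suc d) (q (suc d)))) ⟩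
      D * L + (D * q (suc d) + L)       ∎)
      where
      open ≡-Reasoning
      lem₁ : ∀ d L → suc d * ((suc d + 0) * L) ≡ d * suc d * L + (d * L + L)
      lem₁ = solve-∀
    ... | inj₁ d<j@(s≤s {n = i} _) with any? (λ v → (W v ≟B true) ×-dec ¬? (flawed? (W ∖ v)))
    ...   | yes (v₀ , v₀∈ , ok₀) = ≤-reflexive (begin
      ∑∈ W (λ v → loss (W ∖ v))
        ≡⟨ ∑∈-∖ W (λ v → loss (W ∖ v)) v₀ v₀∈ ⟩
      loss (W ∖ v₀) + ∑∈ (W ∖ v₀) (λ v → loss (W ∖ v))
        ≡⟨ cong₂ _+_ (loss-clique (W ∖ v₀) count₀ d≤j (¬flawed⇒clique ok₀)) (trans (∑∈-cong (W ∖ v₀) others) (∑∈-const (W ∖ v₀) _)) ⟩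
      (D * q (suc j) + L) + count (W ∖ v₀) * (D * q j)
        ≡⟨ cong (λ x → (D * q (suc j) + L) + x * (D * q j)) count₀ ⟩
      (D * q (suc j) + L) + j * (D * q j)
        ≡⟨ lem (D * q (suc j) + L) D j (q j) ⟩
      D * (j * q j) + (D * q (suc j) + L)
        ≡⟨ cong (λ x → D * x + (D * q (suc j) + L)) (q-spec i (m≤n⇒m≤1+n (<⇒≤ k≤n))) ⟩
      D * L + (D * q (suc j) + L) ∎)
      where
      open ≡-Reasoning
      k≤n : suc j ≤ n
      k≤n = subst (_≤ n) eq (count≤n W)
      count₀ = count-∖-suc W v₀ v₀∈ eq
      others : ∀ v → InV (W ∖ v₀) v → loss (W ∖ v) ≡ D * q j
      others v p with ∖-true⁻ W v₀ p
      ... | v∈ , v≢v₀ with flawed? (W ∖ v)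
      ...   | yes fl′ = trans (cong (λ z → ℓ z true) (count-∖-suc W v v∈ eq)) (ℓ-flawed d<j)
      ...   | no ok = ⊥-elim (clique⇒¬flawed (two W v∈ v₀∈ v≢v₀ (≤-trans (s≤s d<j) (≤-reflexive (sym eq)))
                        (¬flawed⇒clique ok) (¬flawed⇒clique ok₀)) fl)
      lem : ∀ z D j x → z + j * (D * x) ≡ D * (j * x) + z
      lem = solve-∀
    ...   | no none = begin
      ∑∈ W (λ v → loss (W ∖ v)) ≡⟨ trans (∑∈-cong W all-flawed) (∑∈-const W _) ⟩
      count W * (D * q j)       ≡⟨ cong (_* (D * q j)) eq ⟩
      suc j * (D * q j)         ≡⟨ lem j D (q j) ⟩
      D * (j * q j) + D * q j   ≡⟨ cong (λ x → D * x + D * q j) (q-spec i (m≤n⇒m≤1+n (<⇒≤ k≤n))) ⟩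
      D * L + D * q j           ≤⟨ +-monoʳ-≤ (D * L) (q-step d≤j k≤n) ⟩
      D * L + (D * q (suc j) + L) ∎
      where
      open ≤-Reasoning
      k≤n : suc j ≤ n
      k≤n = subst (_≤ n) eq (count≤n W)
      all-flawed : ∀ v → InV W v → loss (W ∖ v) ≡ D * q j
      all-flawed v p with flawed? (W ∖ v)
      ... | yes fl′ = trans (cong (λ z → ℓ z true) (count-∖-suc W v p eq)) (ℓ-flawed d<j)
      ... | no ok = ⊥-elim (none (v , p , ok))
      lem : ∀ j D x → suc j * (D * x) ≡ D * (j * x) + D * x
      lem = solve-∀

    -- The additional `L` in `∑-flawed` is paid for by the extra edge of a 1-extension:
    -- `2d + 1 + 1 = 2(d + 1)`.
    local-flawed : ∀ W j → count W ≡ suc j → d ≤ j → NonAdjacentPair W →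
      (2 * d + 1) * L + ∑∈ W (λ v → loss (W ∖ v)) ≤ 2 * suc d * L + suc (suc j) * loss W
    local-flawed W j eq d≤j fl = begin
      (2 * d + 1) * L + ∑∈ W (λ v → loss (W ∖ v)) ≤⟨ +-monoʳ-≤ ((2 * d + 1) * L) (∑-flawed W j eq d≤j fl) ⟩
      (2 * d + 1) * L + (D * L + (D * q k + L))   ≡⟨ lem₁ d L (D * L) (D * q k) ⟩
      2 * suc d * L + (D * L + D * q k)           ≡⟨ cong (λ x → 2 * suc d * L + (D * x + D * q k)) (sym (q-spec j (m≤n⇒m≤1+n (subst (_≤ n) eq (count≤n W))))) ⟩
      2 * suc d * L + (D * (k * q k) + D * q k)   ≡⟨ cong (2 * suc d * L +_) (lem₂ D k (q k)) ⟩
      2 * suc d * L + suc k * (D * q k)           ≡⟨ cong (λ x → 2 * suc d * L + suc k * x) (sym (loss-flawed W eq (s≤s d≤j) fl)) ⟩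
      2 * suc d * L + suc k * loss W              ∎
      where
      open ≤-Reasoning
      k = suc j
      lem₁ : ∀ d L x y → (2 * d + 1) * L + (x + (y + L)) ≡ 2 * suc d * L + (x + y)
      lem₁ = solve-∀
      lem₂ : ∀ D k x → D * (k * x) + D * x ≡ suc k * (D * x)
      lem₂ = solve-∀

    -- The index is the number of edges a vertex with neighbourhood `W` contributes when it is added
    -- by a 0-extension (first two cases) or a 1-extension (last case).
    data Gain (W : VSet n) : ℕ → Set where
      all-neighbours : count W ≤ d → Gain W (count W)
      clique-gain    : d < count W → Gain W d
      flawed-gain    : d < count W → NonAdjacentPair W → Gain W (suc d)

    -- The averaging recursion on a vertex with its neighbours. Any of these `suc (count W)`
    -- vertices may be the one deleted: the vertex itself costs `(2d + 1 - 2g) * L`, while deleting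
    -- a neighbour `v` leaves `loss (W ∖ v)`. The loss is chosen to dominate the average.
    local : ∀ W → ∃ λ g → Gain W g ×
      (2 * d + 1) * L + ∑∈ W (λ v → loss (W ∖ v)) ≤ 2 * g * L + suc (count W) * loss W
    local W = go (count W) refl (count W ≤? d) (flawed? W)
      where
      go : ∀ k → count W ≡ k → Dec (k ≤ d) → Dec (NonAdjacentPair W) → ∃ λ g → Gain W g ×
        (2 * d + 1) * L + ∑∈ W (λ v → loss (W ∖ v)) ≤ 2 * g * L + suc k * loss W
      go k refl (yes k≤d) _ = count W , all-neighbours k≤d , local-small W k refl k≤d
      go k eq (no k≰d) fl? with ≰⇒> k≰d
      go (suc j) eq (no _) (yes fl) | s≤s d≤j =
        suc d , flawed-gain (subst (d <_) (sym eq) (s≤s d≤j)) fl , local-flawed W j eq d≤j fl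
      go (suc j) eq (no _) (no ok) | s≤s d≤j =
        d , clique-gain (subst (d <_) (sym eq) (s≤s d≤j)) , local-clique W j eq d≤j (¬flawed⇒clique ok)

    -- Averaging over the deleted vertex

    Λ : VSet n → ℕ
    Λ S = ∑∈ S (λ u → loss (N S u))

    -- Deleting `v` changes the neighbourhood of `u` only when `v` is a neighbour; the other
    -- vertices, collected in `R`, each leave the loss as it was. The multiple of the loss added on
    -- the left avoids a subtraction.
    local-sum : ∀ S u {m} → InV S u → count S ≡ suc m →
      ∑∈ (S ∖ u) (λ v → loss (N (S ∖ v) u)) + suc (count (N S u)) * loss (N S u)
      ≡ ∑∈ (N S u) (λ v → loss (N S u ∖ v)) + suc m * loss (N S u)
    local-sum S u {m} u∈ eq = begin
      ∑∈ (S ∖ u) (λ v → loss (N (S ∖ v) u)) + suc (count (N S u)) * x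
        ≡⟨ cong (_+ suc (count (N S u)) * x) (trans (sum-cong-≗ split) (∑-distrib-+ (λ v → ⟦ N S u v ⟧ * loss (N S u ∖ v)) (λ v → ⟦ R v ⟧ * x))) ⟩
      A + ∑∈ R (λ _ → x) + suc (count (N S u)) * x
        ≡⟨ cong (λ z → A + z + suc (count (N S u)) * x) (∑∈-const R x) ⟩
      A + count R * x + suc (count (N S u)) * x
        ≡⟨ lem A (count R) (count (N S u)) x ⟩
      A + suc (count (N S u) + count R) * x
        ≡⟨ cong (λ z → A + suc z * x) counts ⟩
      A + suc m * x ∎
      where
      open ≡-Reasoning
      x = loss (N S u)
      A = ∑∈ (N S u) (λ v → loss (N S u ∖ v))
      R : VSet n
      R v = (S ∖ u) v ∧ not (adj G u v)
      lem : ∀ A r k x → A + r * x + suc k * x ≡ A + suc (k + r) * x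
      lem = solve-∀
      S∖u≡S : ∀ v → Adj G u v → (S ∖ u) v ≡ S v
      S∖u≡S v a rewrite ⌊⌋-false⁺ (v ≟ u) (λ v≡u → Adj⇒≢ {H = G} a (sym v≡u)) = ∧-identityʳ (S v)
      split : ∀ v → ⟦ (S ∖ u) v ⟧ * loss (N (S ∖ v) u) ≡ ⟦ N S u v ⟧ * loss (N S u ∖ v) + ⟦ R v ⟧ * x
      split v with adj G u v in a
      ... | true rewrite ∧-zeroʳ ((S ∖ u) v) | S∖u≡S v a | ∧-identityʳ (S v) =
            trans (cong (⟦ S v ⟧ *_) (loss-cong λ w → swap (S w) (not ⌊ w ≟ v ⌋) (adj G u w))) (sym (+-identityʳ _))
        where
        swap : ∀ p q r → (p ∧ q) ∧ r ≡ (p ∧ r) ∧ q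
        swap p q r = trans (∧-assoc p q r) (trans (cong (p ∧_) (∧-comm q r)) (sym (∧-assoc p r q)))
      ... | false rewrite ∧-zeroʳ (S v) | ∧-identityʳ ((S ∖ u) v) = cong (⟦ (S ∖ u) v ⟧ *_) (loss-cong same)
        where
        same : ∀ w → N (S ∖ v) u w ≡ N S u w
        same w with w ≟ v
        ... | yes refl rewrite a = trans (∧-zeroʳ _) (sym (∧-zeroʳ _))
        ... | no _ = cong (_∧ adj G u w) (∧-identityʳ (S w))
      counts : count (N S u) + count R ≡ m
      counts = trans (sym (∑-distrib-+ (⟦_⟧ ∘ N S u) (⟦_⟧ ∘ R))) (trans (sum-cong-≗ part) (count-∖-suc S u u∈ eq))
        where
        part : ∀ v → ⟦ N S u v ⟧ + ⟦ R v ⟧ ≡ ⟦ (S ∖ u) v ⟧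
        part v with adj G u v in a
        ... | true rewrite ∧-zeroʳ ((S ∖ u) v) | S∖u≡S v a | ∧-identityʳ (S v) = +-identityʳ _
        ... | false rewrite ∧-zeroʳ (S v) | ∧-identityʳ ((S ∖ u) v) = refl

    local-∑ : ∀ S u {m} → InV S u → count S ≡ suc m →
      (2 * d + 1) * L + ∑∈ (S ∖ u) (λ v → loss (N (S ∖ v) u))
      ≤ 2 * proj₁ (local (N S u)) * L + suc m * loss (N S u)
    local-∑ S u {m} u∈ eq = +-cancelʳ-≤ (suc (count (N S u)) * x) _ _ (begin
      (a + ∑∈ (S ∖ u) (λ v → loss (N (S ∖ v) u))) + suc (count (N S u)) * x ≡⟨ +-assoc a _ _ ⟩
      a + (∑∈ (S ∖ u) (λ v → loss (N (S ∖ v) u)) + suc (count (N S u)) * x) ≡⟨ cong (a +_) (local-sum S u u∈ eq) ⟩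
      a + (∑∈ (N S u) (λ v → loss (N S u ∖ v)) + suc m * x)                 ≡⟨ sym (+-assoc a _ _) ⟩
      a + ∑∈ (N S u) (λ v → loss (N S u ∖ v)) + suc m * x                   ≤⟨ +-monoˡ-≤ (suc m * x) (proj₂ (proj₂ (local (N S u)))) ⟩
      b + suc (count (N S u)) * x + suc m * x                               ≡⟨ swap b _ _ ⟩
      (b + suc m * x) + suc (count (N S u)) * x                             ∎)
      where
      open ≤-Reasoning
      x = loss (N S u)
      a = (2 * d + 1) * L
      b = 2 * proj₁ (local (N S u)) * L
      swap : ∀ x y z → x + y + z ≡ x + z + y
      swap = solve-∀

    -- Swaps the deleted vertex `v` with the vertex `u` whose loss is measured; both range over
    -- ordered pairs of distinct vertices of `S`.
    ∑-Λ : ∀ S → ∑∈ S (λ v → Λ (S ∖ v)) ≡ ∑∈ S (λ u → ∑∈ (S ∖ u) (λ v → loss (N (S ∖ v) u)))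
    ∑-Λ S = begin
      ∑∈ S (λ v → Λ (S ∖ v))
        ≡⟨ sum-cong-≗ (λ v → *-distribˡ-sum ⟦ S v ⟧ (λ u → ⟦ (S ∖ v) u ⟧ * h v u)) ⟩
      sum (λ v → sum (λ u → ⟦ S v ⟧ * (⟦ (S ∖ v) u ⟧ * h v u)))
        ≡⟨ ∑-comm (λ v u → ⟦ S v ⟧ * (⟦ (S ∖ v) u ⟧ * h v u)) ⟩
      sum (λ u → sum (λ v → ⟦ S v ⟧ * (⟦ (S ∖ v) u ⟧ * h v u)))
        ≡⟨ sum-cong-≗ (λ u → sum-cong-≗ (λ v → flip u v)) ⟩
      sum (λ u → sum (λ v → ⟦ S u ⟧ * (⟦ (S ∖ u) v ⟧ * h v u)))
        ≡⟨ sum-cong-≗ (λ u → sym (*-distribˡ-sum ⟦ S u ⟧ (λ v → ⟦ (S ∖ u) v ⟧ * h v u))) ⟩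
      ∑∈ S (λ u → ∑∈ (S ∖ u) (λ v → h v u)) ∎
      where
      open ≡-Reasoning
      h : Fin n → Fin n → ℕ
      h v u = loss (N (S ∖ v) u)
      ≟-comm : ∀ (u v : Fin n) → ⌊ u ≟ v ⌋ ≡ ⌊ v ≟ u ⌋
      ≟-comm u v with u ≟ v
      ... | yes refl = sym (⌊⌋-true⁺ (u ≟ u) refl)
      ... | no u≢v = sym (⌊⌋-false⁺ (v ≟ u) (u≢v ∘ sym))
      flip : ∀ u v → ⟦ S v ⟧ * (⟦ (S ∖ v) u ⟧ * h v u) ≡ ⟦ S u ⟧ * (⟦ (S ∖ u) v ⟧ * h v u)
      flip u v rewrite ≟-comm u v with S v | S u
      ... | true | true = refl
      ... | true | false = refl
      ... | false | true = refl
      ... | false | false = refl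

    -- Summing `local-∑` over `u` and swapping by `∑-Λ` gives the wanted inequality summed over `v`,
    -- with one copy of `Λ S` for each of the `suc m` vertices. So it holds for some `v`.
    good-vertex : ∀ S {m} → count S ≡ suc m →
      ∃ λ v → InV S v × (2 * d + 1) * L + Λ (S ∖ v) ≤ 2 * proj₁ (local (N S v)) * L + Λ S
    good-vertex S {m} eq = ∑∈-pigeonhole S _ _ (≤-trans (s≤s z≤n) (≤-reflexive (sym eq))) (begin
      ∑∈ S (λ v → a + Λ (S ∖ v))
        ≡⟨ ∑∈-+ S (λ _ → a) (λ v → Λ (S ∖ v)) ⟩
      ∑∈ S (λ _ → a) + ∑∈ S (λ v → Λ (S ∖ v))
        ≡⟨ cong (∑∈ S (λ _ → a) +_) (∑-Λ S) ⟩
      ∑∈ S (λ _ → a) + ∑∈ S (λ u → ∑∈ (S ∖ u) (λ v → loss (N (S ∖ v) u)))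
        ≡⟨ sym (∑∈-+ S (λ _ → a) _) ⟩
      ∑∈ S (λ u → a + ∑∈ (S ∖ u) (λ v → loss (N (S ∖ v) u)))
        ≤⟨ ∑∈-mono S (λ u p → local-∑ S u p eq) ⟩
      ∑∈ S (λ u → b u + suc m * loss (N S u))
        ≡⟨ ∑∈-+ S b (λ u → suc m * loss (N S u)) ⟩
      ∑∈ S b + ∑∈ S (λ u → suc m * loss (N S u))
        ≡⟨ cong (∑∈ S b +_) (trans (sum-cong-≗ (λ u → pull ⟦ S u ⟧ (suc m) (loss (N S u)))) (sym (*-distribˡ-sum (suc m) (λ u → ⟦ S u ⟧ * loss (N S u))))) ⟩
      ∑∈ S b + suc m * Λ S
        ≡⟨ cong (λ z → ∑∈ S b + z * Λ S) (sym eq) ⟩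
      ∑∈ S b + count S * Λ S
        ≡⟨ cong (∑∈ S b +_) (sym (∑∈-const S (Λ S))) ⟩
      ∑∈ S b + ∑∈ S (λ _ → Λ S)
        ≡⟨ sym (∑∈-+ S b (λ _ → Λ S)) ⟩
      ∑∈ S (λ v → b v + Λ S) ∎)
      where
      open ≤-Reasoning
      a = (2 * d + 1) * L
      b : Fin n → ℕ
      b v = 2 * proj₁ (local (N S v)) * L
      pull : ∀ x y z → x * (y * z) ≡ y * (x * z)
      pull = solve-∀

-- Extensions inside a closed edge set

module Extension {n : ℕ} (c : ℕ) (M : Matroid n) (ar : IsAbstractRigidity (suc c) M)
                 (ext : OneExtendable (suc c) M) (G : ESet n) (closed : cl M G ⊆E G) where

  open MatroidLists M
  open Rigidity c M ar
  open Cliques G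

  -- Without `a` and `b` there remain `d` vertices forming a clique that both of them see, so `glue`
  -- yields the edge `ab`. Any other pair survives one of the two deletions.
  two-deletions : TwoDeletions d
  two-deletions W {a} {b} a∈ b∈ a≢b d+2≤ cla clb = whole
    where
    W′ = W ∖ a ∖ b
    d≤W′ : d ≤ count W′
    d≤W′ = ≤-pred (≤-pred (subst (suc (suc d) ≤_)
      (trans (count-∖ W a a∈) (cong suc (count-∖ (W ∖ a) b (∖-true⁺ W a b∈ (a≢b ∘ sym))))) d+2≤))
    pick = count⇒AtLeast W′ d≤W′
    f = proj₁ pick
    f∈ : ∀ i → InV W (f i) × f i ≢ a × f i ≢ b
    f∈ i = let p , f≢b = ∖-true⁻ (W ∖ a) b (proj₂ (proj₂ pick) i)
               q , f≢a = ∖-true⁻ W a p in q , f≢a , f≢b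
    ab : Adj G a b
    ab = glue closed f (proj₁ (proj₂ pick))
      (λ i j → cla (∖-true⁺ W a (proj₁ (f∈ i)) (proj₁ (proj₂ (f∈ i)))) (∖-true⁺ W a (proj₁ (f∈ j)) (proj₁ (proj₂ (f∈ j)))))
      (λ i → clb (∖-true⁺ W b (proj₁ (f∈ i)) (proj₂ (proj₂ (f∈ i)))) (∖-true⁺ W b a∈ a≢b) (proj₁ (proj₂ (f∈ i))))
      (λ i → cla (∖-true⁺ W a (proj₁ (f∈ i)) (proj₁ (proj₂ (f∈ i)))) (∖-true⁺ W a b∈ (a≢b ∘ sym)) (proj₂ (proj₂ (f∈ i))))
      a≢b
    whole : Clique W
    whole {x} {y} p q x≢y with x ≟ a | y ≟ a | x ≟ b | y ≟ b
    ... | no x≢a | no y≢a | _ | _ = cla (∖-true⁺ W a p x≢a) (∖-true⁺ W a q y≢a) x≢y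
    ... | _ | _ | no x≢b | no y≢b = clb (∖-true⁺ W b p x≢b) (∖-true⁺ W b q y≢b) x≢y
    ... | yes refl | _ | yes refl | _ = ⊥-elim (a≢b refl)
    ... | yes refl | _ | no _ | yes refl = ab
    ... | no _ | yes refl | yes refl | _ = Adj-sym {H = G} ab
    ... | no _ | yes refl | no _ | yes refl = ⊥-elim (a≢b refl)

  _⊆G[_] : List (Edge n) → VSet n → Set
  l ⊆G[ S ] = ∀ {e} → e ∈ l → e ∈E G × InK (InV S) e

  module _ (S : VSet n) (v : Fin n) (v∈ : InV S v) (l : List (Edge n))
           (ind : IndepList l) (l⊆ : l ⊆G[ S ∖ v ]) where

    v∉l : ¬ VE ⟪ l ⟫ v
    v∉l (e , p , inc) with l⊆ (⟪⟫⇒∈ l p)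
    v∉l (e , p , inj₁ refl) | _ , q , _ = proj₂ (∖-true⁻ S v q) refl
    v∉l (e , p , inj₂ refl) | _ , _ , q = proj₂ (∖-true⁻ S v q) refl

    N≢v : ∀ {u} → InV (N S v) u → u ≢ v
    N≢v p u≡v = Adj⇒≢ {H = G} (proj₂ (∧-true⁻ p)) (sym u≡v)

    star-⊆ : ∀ {m} (f : Fin m → Fin n) f≢v → (∀ i → InV (N S v) (f i)) → (star v f f≢v ++ l) ⊆G[ S ]
    star-⊆ f f≢v f∈ {e} p with ∈-++⁻ (star v f f≢v) p
    ... | inj₂ q = let e∈G , a , b = l⊆ q in e∈G , proj₁ (∖-true⁻ S v a) , proj₁ (∖-true⁻ S v b)
    ... | inj₁ q = let i , j = star-∈⁻ v f f≢v q
                       fi∈S , vfi = ∧-true⁻ (f∈ i)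
                   in adj-edge⁻ {H = G} e vfi j , InK-Joins⁺ {P = InV S} e j v∈ fi∈S

    star-length : ∀ {m} (f : Fin m → Fin n) f≢v → length (star v f f≢v ++ l) ≡ m + length l
    star-length f f≢v = trans (length-++ (star v f f≢v)) (cong (_+ length l) (length-tabulate (λ i → proj₁ (join (f≢v i)))))

    Extended : ℕ → Set
    Extended g = ∃ λ l′ → IndepList l′ × l′ ⊆G[ S ] × length l′ ≡ g + length l

    extend₀ : ∀ g → g ≤ d → g ≤ count (N S v) → Extended g
    extend₀ g g≤d g≤k =
      let f , f-inj , f∈ = count⇒AtLeast (N S v) g≤k
          f≢v = λ i → N≢v (f∈ i)
      in star v f f≢v ++ l , zero-extension l v f f≢v f-inj g≤d ind v∉l , star-⊆ f f≢v f∈ , star-length f f≢v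

    -- As `G` is closed and misses `xy`, this edge lies outside the closure of `l` and can be added
    -- to it. The 1-extension then trades `xy` for `d + 1` spokes at `v`, all of which lie in `G`.
    extend₁ : d < count (N S v) → NonAdjacentPair (N S v) → Extended (suc d)
    extend₁ d<k (x , y , x∈ , y∈ , x≢y , x≁y) =
      star v f f≢v ++ l ,
      Independent⇒IndepList (star v f f≢v ++ l)
        (unique-++⁺ (star-unique v f f≢v f-inj) (IndepList⇒Unique l ind) disjoint)
        (ext ⟪ xy ∷ l ⟫ ⟪ star v f f≢v ++ l ⟫ x y v rest
          (insert-independent ⟪ l ⟫ xy (IndepList⇒Independent l ind) xy∉)
          (xy , ∈⇒⟪⟫ {l = xy ∷ l} (here refl) , jxy) x≢y rest-inj
          (λ i → proj₁ (proj₂ (rest∈ i))) (λ i → proj₂ (proj₂ (rest∈ i)))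
          v∉F (λ i → f≢v (suc (suc i))) (λ e → mk⇔ (fwd e) (bwd e))) ,
      star-⊆ f f≢v f∈ , star-length f f≢v
      where
      xy = proj₁ (join x≢y)
      jxy = proj₂ (join x≢y)
      W = N S v
      -- Setting `x` and `y` aside from at least `d + 1` neighbours leaves the `c = d - 1` vertices
      -- for `rest`.
      c≤ : c ≤ count (W ∖ x ∖ y)
      c≤ = ≤-pred (≤-pred (subst (suc (suc c) ≤_)
        (trans (count-∖ W x x∈) (cong suc (count-∖ (W ∖ x) y (∖-true⁺ W x y∈ (x≢y ∘ sym))))) d<k))
      pick = count⇒AtLeast (W ∖ x ∖ y) c≤
      rest = proj₁ pick
      rest-inj : Injective _≡_ _≡_ rest
      rest-inj = proj₁ (proj₂ pick)
      rest∈ : ∀ i → InV W (rest i) × rest i ≢ x × rest i ≢ y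
      rest∈ i = let p , ≢y = ∖-true⁻ (W ∖ x) y (proj₂ (proj₂ pick) i)
                    q , ≢x = ∖-true⁻ W x p in q , ≢x , ≢y
      f : Fin (suc d) → Fin n
      f zero = x
      f (suc zero) = y
      f (suc (suc i)) = rest i
      f∈ : ∀ i → InV W (f i)
      f∈ zero = x∈
      f∈ (suc zero) = y∈
      f∈ (suc (suc i)) = proj₁ (rest∈ i)
      f≢v : ∀ i → f i ≢ v
      f≢v i = N≢v (f∈ i)
      f-inj : Injective _≡_ _≡_ f
      f-inj {zero} {zero} _ = refl
      f-inj {zero} {suc zero} p = ⊥-elim (x≢y p)
      f-inj {zero} {suc (suc j)} p = ⊥-elim (proj₁ (proj₂ (rest∈ j)) (sym p))
      f-inj {suc zero} {zero} p = ⊥-elim (x≢y (sym p))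
      f-inj {suc zero} {suc zero} _ = refl
      f-inj {suc zero} {suc (suc j)} p = ⊥-elim (proj₂ (proj₂ (rest∈ j)) (sym p))
      f-inj {suc (suc i)} {zero} p = ⊥-elim (proj₁ (proj₂ (rest∈ i)) p)
      f-inj {suc (suc i)} {suc zero} p = ⊥-elim (proj₂ (proj₂ (rest∈ i)) p)
      f-inj {suc (suc i)} {suc (suc j)} p = cong (λ k → suc (suc k)) (rest-inj p)
      ¬xy : ∀ e → e ∈E G → ¬ Joins e x y
      ¬xy e p j = true≢false (adj⁺ {H = G} e p j) x≁y
      xy∉ : cl M ⟪ l ⟫ xy ≡ false
      xy∉ = ¬true⇒false λ p →
        ¬xy xy (closed xy (cl-mono M ⟪ l ⟫ G (λ e q → proj₁ (l⊆ (⟪⟫⇒∈ l q))) xy p)) jxy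
      disjoint : ∀ {e} → ¬ (e ∈ star v f f≢v × e ∈ l)
      disjoint {e} (p , q) = let i , j = star-∈⁻ v f f≢v p in v∉l (e , ∈⇒⟪⟫ q , Joins⇒Incidentˡ e j)
      v∉F : ¬ VE ⟪ xy ∷ l ⟫ v
      v∉F (e , p , inc) with ⟪⟫⇒∈ (xy ∷ l) p
      ... | there q = v∉l (e , ∈⇒⟪⟫ q , inc)
      ... | here refl with Joins-end xy inc jxy
      ...   | inj₁ r = f≢v zero (sym r)
      ...   | inj₂ r = f≢v (suc zero) (sym r)
      Result : Edge n → Set
      Result e = (e ∈E ⟪ xy ∷ l ⟫ × ¬ Joins e x y) ⊎ Joins e v x ⊎ Joins e v y ⊎ (∃ λ i → Joins e v (rest i))
      fwd : ∀ e → e ∈E ⟪ star v f f≢v ++ l ⟫ → Result e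
      fwd e p with ∈-++⁻ (star v f f≢v) (⟪⟫⇒∈ (star v f f≢v ++ l) p)
      ... | inj₂ q = inj₁ (∈⇒⟪⟫ {l = xy ∷ l} (there q) , ¬xy e (proj₁ (l⊆ q)))
      ... | inj₁ q with star-∈⁻ v f f≢v q
      ...   | zero , j = inj₂ (inj₁ j)
      ...   | suc zero , j = inj₂ (inj₂ (inj₁ j))
      ...   | suc (suc i) , j = inj₂ (inj₂ (inj₂ (i , j)))
      spoke : ∀ e i → Joins e v (f i) → e ∈E ⟪ star v f f≢v ++ l ⟫
      spoke e i j = ∈⇒⟪⟫ (∈-++⁺ˡ (star-∈⁺ v f f≢v i j))
      bwd : ∀ e → Result e → e ∈E ⟪ star v f f≢v ++ l ⟫
      bwd e (inj₂ (inj₁ j)) = spoke e zero j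
      bwd e (inj₂ (inj₂ (inj₁ j))) = spoke e (suc zero) j
      bwd e (inj₂ (inj₂ (inj₂ (i , j)))) = spoke e (suc (suc i)) j
      bwd e (inj₁ (p , ¬j)) with ⟪⟫⇒∈ (xy ∷ l) p
      ... | here refl = ⊥-elim (¬j jxy)
      ... | there q = ∈⇒⟪⟫ (∈-++⁺ʳ (star v f f≢v) q)

  -- The lower bound for independent sets

  abstract
    -- A common multiple of `1` to `n + 1`; a clique neighbourhood of up to `n` vertices has a loss
    -- with denominator one larger than its size.
    L : ℕ
    L = suc n !

    q : ℕ → ℕ
    q zero = 0
    q (suc m) = L / suc m

    q-spec : ∀ m → suc m ≤ suc n → suc m * q (suc m) ≡ L
    q-spec m m≤n = m*[n/m]≡n {suc m} (∣-trans (m∣m*n (m !)) (m≤n⇒m!∣n! m≤n))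

    L>0 : 1 ≤ L
    L>0 = 1≤n! (suc n)

  open Loss c L q q-spec two-deletions hiding (d)

  Bounded : ℕ → VSet n → Set
  Bounded m S = ∃ λ l → IndepList l × l ⊆G[ S ] × (2 * d + 1) * m * L ≤ 2 * length l * L + Λ S

  bounded-step : ∀ {m} S v {g} → InV S v → Gain (N S v) g →
    (2 * d + 1) * L + Λ (S ∖ v) ≤ 2 * g * L + Λ S → Bounded m (S ∖ v) → Bounded (suc m) S
  bounded-step {m} S v {g} v∈ gain good (l , ind , l⊆ , bound) =
    let l′ , ind′ , l′⊆ , len = extended gain in l′ , ind′ , l′⊆ , (begin
      (2 * d + 1) * suc m * L                          ≡⟨ lem₁ (2 * d + 1) m L ⟩
      (2 * d + 1) * L + (2 * d + 1) * m * L            ≤⟨ +-monoʳ-≤ ((2 * d + 1) * L) bound ⟩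
      (2 * d + 1) * L + (2 * length l * L + Λ (S ∖ v)) ≡⟨ lem₂ ((2 * d + 1) * L) (2 * length l * L) (Λ (S ∖ v)) ⟩
      2 * length l * L + ((2 * d + 1) * L + Λ (S ∖ v)) ≤⟨ +-monoʳ-≤ (2 * length l * L) good ⟩
      2 * length l * L + (2 * g * L + Λ S)             ≡⟨ lem₃ (length l) g L (Λ S) ⟩
      2 * (g + length l) * L + Λ S                     ≡⟨ cong (λ z → 2 * z * L + Λ S) (sym len) ⟩
      2 * length l′ * L + Λ S                          ∎)
    where
    open ≤-Reasoning
    extended : ∀ {g} → Gain (N S v) g → Extended S v v∈ l ind l⊆ g
    extended (all-neighbours k≤d) = extend₀ S v v∈ l ind l⊆ (count (N S v)) k≤d ≤-refl
    extended (clique-gain d<k) = extend₀ S v v∈ l ind l⊆ d ≤-refl (<⇒≤ d<k)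
    extended (flawed-gain d<k fl) = extend₁ S v v∈ l ind l⊆ d<k fl
    lem₁ : ∀ a m L → a * suc m * L ≡ a * L + a * m * L
    lem₁ = solve-∀
    lem₂ : ∀ a b z → a + (b + z) ≡ b + (a + z)
    lem₂ = solve-∀
    lem₃ : ∀ a g L z → 2 * a * L + (2 * g * L + z) ≡ 2 * (g + a) * L + z
    lem₃ = solve-∀

  lower-bound : ∀ m S → count S ≡ m → Bounded m S
  lower-bound zero S eq = [] , tt , (λ ()) , ≤-trans (≤-reflexive (cong (_* L) (*-zeroʳ (2 * d + 1)))) z≤n
  lower-bound (suc m) S eq =
    let v , v∈ , good = good-vertex S eq
    in bounded-step {m} S v v∈ (proj₁ (proj₂ (local (N S v)))) good (lower-bound m (S ∖ v) (count-∖-suc S v v∈ eq))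

  -- `lower-bound` would give at least `d` independent edges per vertex, but `steinitz` against
  -- `spanning` allows only `d * (count X ∸ 1)` in total.
  no-flawed-core : ∀ X → 1 ≤ count X →
    (∀ u → InV X u → NonAdjacentPair (N X u) × D ≤ count (N X u)) → ⊥
  no-flawed-core X ne core =
    let l , ind , l⊆ , lower = lower-bound (count X) X refl
        B , lenB , span = spanning (count X) X refl
        l≤B = steinitz l B ind λ {e} p →
          let _ , a , b = l⊆ p in adj-edge⁻ {H = cl M ⟪ B ⟫} e (span a b (lo≢hi e)) (Joins-lo-hi e)
    in <⇒≱ (upper (count X) ne (≤-trans l≤B lenB)) (below (length l) lower)
    where
    upper : ∀ m {a} → 1 ≤ m → a ≤ d * (m ∸ 1) → a < d * m
    upper (suc m) {a} _ p = subst (a <_) (sym (*-suc d m)) (≤-<-trans p (m<n+m (d * m) {d} (s≤s z≤n)))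
    -- A flawed neighbourhood of size `k ≥ D` has loss `D / k ≤ 1` in units of `L`.
    loss≤L : ∀ u → InV X u → loss (N X u) ≤ L
    loss≤L u p with core u p
    ... | fl , D≤k = aux (count (N X u)) refl D≤k
      where
      open ≤-Reasoning
      aux : ∀ k → count (N X u) ≡ k → D ≤ k → loss (N X u) ≤ L
      aux (suc j) eq D≤k = begin
        loss (N X u)      ≡⟨ loss-flawed (N X u) eq (≤-trans (m≤n*m (suc d) d) D≤k) fl ⟩
        D * q (suc j)     ≤⟨ *-monoˡ-≤ (q (suc j)) D≤k ⟩
        suc j * q (suc j) ≡⟨ q-spec j (m≤n⇒m≤1+n (subst (_≤ n) eq (count≤n (N X u)))) ⟩
        L                 ∎
    -- With all losses at most `L`, the bound reads `(2d + 1)x ≤ 2a + x` for `x = count X`, hence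
    -- `d * x ≤ a`.
    below : ∀ a → (2 * d + 1) * count X * L ≤ 2 * a * L + Λ X → d * count X ≤ a
    below a h = *-cancelˡ-≤ 2 (*-cancelʳ-≤ _ _ L {{>-nonZero L>0}} (+-cancelʳ-≤ (count X * L) _ _ (begin
      2 * (d * count X) * L + count X * L ≡⟨ lem d (count X) L ⟩
      (2 * d + 1) * count X * L           ≤⟨ h ⟩
      2 * a * L + Λ X                     ≤⟨ +-monoʳ-≤ (2 * a * L) (≤-trans (∑∈-mono X loss≤L) (≤-reflexive (∑∈-const X L))) ⟩
      2 * a * L + count X * L             ∎)))
      where
      open ≤-Reasoning
      lem : ∀ d x L → 2 * (d * x) * L + x * L ≡ (2 * d + 1) * x * L
      lem = solve-∀

-- From connectivity to rigidity

module Connected {n : ℕ} (c : ℕ) (M : Matroid n) (ar : IsAbstractRigidity (suc c) M)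
                 (ext : OneExtendable (suc c) M) (U : VSet n) (E : ESet n)
                 (sub : Subgraph U E) (conn : KConnected (suc c * suc (suc c)) U E) where

  G : ESet n
  G = cl M E

  open Rigidity c M ar
  open Cliques G
  open Extension c M ar ext G (cl-idem M E)

  k : ℕ
  k = d * suc d

  G⊆KU : ∀ e → e ∈E G → InK (InV U) e
  G⊆KU e p = let a , b = cl⊆K E e p in end a , end b
    where
    end : ∀ {u} → VE E u → InV U u
    end (g , q , inj₁ refl) = proj₁ (sub g q)
    end (g , q , inj₂ refl) = proj₂ (sub g q)

  E⇒Adj : ∀ e {u w} → e ∈E E → Joins e u w → Adj G u w
  E⇒Adj e p j = adj⁺ {H = G} e (cl-incl M E e p) j

  Reach-start : ∀ {P u v} → Reach E P u v → P u
  Reach-start (here p) = p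
  Reach-start (step _ _ _ p _) = p

  few : ∀ (S : VSet n) → ¬ (k ≤ count S) → ¬ AtLeast k (InV S)
  few S h a = h (AtLeast⇒count k S a)

  -- A neighbourhood with fewer than `k` vertices would separate `u` from any non-neighbour. If
  -- there is no non-neighbour, all the other vertices of `U` are neighbours, and there are at least
  -- `k` of them.
  degree : ∀ u → InV U u → k ≤ count (N U u)
  degree u u∈ with k ≤? count (N U u)
  ... | yes p = p
  ... | no k≰ with any? (λ w → ((U ∖ u) w ≟B true) ×-dec (N U u w ≟B false))
  ...   | no none = ≤-trans (≤-pred (subst (suc k ≤_) (count-∖ U u u∈) (AtLeast⇒count (suc k) U (proj₁ conn))))
                      (count-mono λ w p → ¬false⇒true λ q → none (w , p , q))
    where
    ¬false⇒true : ∀ {b} → ¬ (b ≡ false) → b ≡ true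
    ¬false⇒true {true} _ = refl
    ¬false⇒true {false} h = ⊥-elim (h refl)
  ...   | yes (w , p , w∉N) = ⊥-elim (escape (proj₂ conn (N U u) (few (N U u) k≰) u w u∈ (N-irrefl U u) w∈ w∉N))
    where
    w∈ = proj₁ (∖-true⁻ U u p)
    w≢u = proj₂ (∖-true⁻ U u p)
    N-irrefl : ∀ S u → N S u u ≡ false
    N-irrefl S u = ¬true⇒false λ q → Adj⇒≢ {H = G} (proj₂ (∧-true⁻ q)) refl
    escape : ¬ Reach E (λ x → U x ≡ true × N U u x ≡ false) u w
    escape (here _) = w≢u refl
    escape (step e e∈ j _ r) = let a , b = Reach-start r in true≢false (∧-true⁺ a (E⇒Adj e e∈ j)) b

  X : VSet n
  X u = U u ∧ ⌊ flawed? (N U u) ⌋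

  X⁻ : ∀ {u} → InV X u → InV U u × NonAdjacentPair (N U u)
  X⁻ {u} p = let a , b = ∧-true⁻ p in a , ⌊⌋-true⁻ (flawed? (N U u)) b

  ∉X⇒clique : ∀ {u} → InV U u → X u ≡ false → Clique (N U u)
  ∉X⇒clique {u} u∈ p = ¬flawed⇒clique λ fl → true≢false (∧-true⁺ u∈ (⌊⌋-true⁺ (flawed? (N U u)) fl)) p

  NX⇒NU : ∀ {u w} → InV (N X u) w → InV (N U u) w
  NX⇒NU p = let a , b = ∧-true⁻ p in ∧-true⁺ (proj₁ (X⁻ a)) b

  -- The closed neighbourhood of z is left only through vertices of X.
  separator : ∀ {z y} → InV U z → InV U y → Clique (N U z) → y ≢ z → adj G z y ≡ false → k ≤ count (N X z)
  separator {z} {y} z∈ y∈ clz y≢z z≁y with k ≤? count (N X z)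
  ... | yes p = p
  ... | no k≰ = ⊥-elim (end (trapped (inj₁ refl) (proj₂ conn (N X z) (few (N X z) k≰) z y z∈
          (¬true⇒false λ q → Adj⇒≢ {H = G} (proj₂ (∧-true⁻ q)) refl) y∈
          (¬true⇒false λ q → true≢false (proj₂ (∧-true⁻ {X y} q)) z≁y))))
    where
    Near : Fin n → Set
    Near w = w ≡ z ⊎ Adj G z w
    end : ¬ Near y
    end (inj₁ p) = y≢z p
    end (inj₂ p) = true≢false p z≁y
    next : ∀ {w w′} → Near w → U w ≡ true × N X z w ≡ false → InV U w′ → Adj G w w′ → Near w′
    next (inj₁ refl) _ _ a = inj₂ a
    next {w} {w′} (inj₂ zw) (w∈ , w∉) w′∈ a with w′ ≟ z
    ... | yes p = inj₁ p
    ... | no w′≢z = inj₂ (∉X⇒clique w∈ (¬true⇒false λ q → true≢false (∧-true⁺ q zw) w∉)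
                      (∧-true⁺ z∈ (Adj-sym {H = G} zw)) (∧-true⁺ w′∈ a) (w′≢z ∘ sym))
    trapped : ∀ {w} → Near w → Reach E (λ x → U x ≡ true × N X z x ≡ false) w y → Near y
    trapped nw (here _) = nw
    trapped nw (step e e∈ j p r) = trapped (next nw p (proj₁ (Reach-start r)) (E⇒Adj e e∈ j)) r

  glue-clique : ∀ W {a b} → Clique W → d ≤ count W → (∀ w → InV W w → Adj G w a) → (∀ w → InV W w → Adj G w b) →
                a ≢ b → Adj G a b
  glue-clique W clW d≤ wa wb a≢b =
    let f , f-inj , f∈ = count⇒AtLeast W d≤
    in glue (cl-idem M E) f f-inj (λ i j → clW (f∈ i) (f∈ j)) (λ i → wa _ (f∈ i)) (λ i → wb _ (f∈ i)) a≢b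

  -- Otherwise `N X z`, a clique of at least `d` vertices, would be seen entirely by `z` and `y`,
  -- and `glue` would make these two adjacent.
  missed : ∀ {z y} → Clique (N U z) → k ≤ count (N X z) → y ≢ z → adj G z y ≡ false →
           ∃ λ w → InV (N X z) w × adj G w y ≡ false
  missed {z} {y} clz k≤ y≢z z≁y with any? (λ w → (N X z w ≟B true) ×-dec (adj G w y ≟B false))
  ... | yes r = r
  ... | no none = ⊥-elim (true≢false
          (glue-clique (N X z) (λ p q → clz (NX⇒NU p) (NX⇒NU q)) (≤-trans (m≤m*n d (suc d)) k≤)
            (λ w p → Adj-sym {H = G} (proj₂ (∧-true⁻ p))) sees (y≢z ∘ sym)) z≁y)
    where
    sees : ∀ w → InV (N X z) w → Adj G w y
    sees w p with adj G w y in eq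
    ... | true = refl
    ... | false = ⊥-elim (none (w , p , eq))

  ≢-source : ∀ {u w x} → Adj G u x → adj G w x ≡ false → u ≢ w
  ≢-source p q refl = true≢false p q

  ≢-target : ∀ {u w x} → Adj G x u → adj G x w ≡ false → u ≢ w
  ≢-target p q refl = true≢false p q

  -- If all neighbours of `u` lie in `X`, nothing is lost by restricting to `X`. Otherwise a
  -- neighbour `z` outside `X` has a clique neighbourhood containing `u`, so the vertices of `N X z`
  -- other than `u` are neighbours of `u`. A vertex `y` of `N X u` not adjacent to `z` makes up for
  -- `u` in the count and provides the non-adjacent pair.
  core : ∀ u → InV X u → NonAdjacentPair (N X u) × k ≤ count (N X u)
  core u u∈X with any? (λ z → (N U u z ≟B true) ×-dec (X z ≟B false))
  ... | no none = pair (proj₂ (X⁻ u∈X)) , ≤-trans (degree u (proj₁ (X⁻ u∈X))) (count-mono inX)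
    where
    inX : ∀ w → InV (N U u) w → InV (N X u) w
    inX w p with X w in eq
    ... | true = proj₂ (∧-true⁻ {U w} p)
    ... | false = ⊥-elim (none (w , p , eq))
    pair : NonAdjacentPair (N U u) → NonAdjacentPair (N X u)
    pair (x , y , p , q , r) = x , y , inX x p , inX y q , r
  ... | yes (z , z∈N , z∉X) = pair , large
    where
    u∈ = proj₁ (X⁻ u∈X)
    z∈ = proj₁ (∧-true⁻ z∈N)
    uz : Adj G u z
    uz = proj₂ (∧-true⁻ {U z} z∈N)
    clz : Clique (N U z)
    clz = ∉X⇒clique z∈ z∉X
    Outside : VSet n → Set
    Outside S = ∃ λ y → InV (N S u) y × y ≢ z × adj G z y ≡ false
    -- A non-adjacent pair at `u` cannot lie entirely in the closed neighbourhood of `z`, which is a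
    -- clique.
    outside-U : Outside U
    outside-U with proj₂ (X⁻ u∈X)
    ... | x , y , x∈ , y∈ , x≢y , x≁y with x ≟ z | y ≟ z
    ...   | yes refl | _ = y , y∈ , (x≢y ∘ sym) , x≁y
    ...   | no x≢z | yes refl = x , x∈ , x≢z , ¬true⇒false λ a → true≢false (Adj-sym {H = G} a) x≁y
    ...   | no x≢z | no y≢z with adj G z x in zx | adj G z y in zy
    ...     | false | _ = x , x∈ , x≢z , zx
    ...     | true | false = y , y∈ , y≢z , zy
    ...     | true | true = ⊥-elim (true≢false
                (clz (∧-true⁺ (proj₁ (∧-true⁻ x∈)) zx) (∧-true⁺ (proj₁ (∧-true⁻ y∈)) zy) x≢y) x≁y)
    outside-X : Outside X
    outside-X with outside-U
    ... | y , y∈N , y≢z , z≁y with ∧-true⁻ {U y} y∈N | X y in eq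
    ...   | y∈ , uy | true = y , ∧-true⁺ eq uy , y≢z , z≁y
    -- If `y` is outside `X`, its neighbourhood is a clique too. Then `missed`, with `y` and `z` in
    -- exchanged roles, gives `w` in `X` not adjacent to `z`; both `u` and `w` lie in the clique at
    -- `y`, hence are adjacent.
    ...   | y∈ , uy | false =
            let y≁z = ¬true⇒false λ a → true≢false (Adj-sym {H = G} a) z≁y
                cly = ∉X⇒clique y∈ eq
                w , w∈ , w≁z = missed cly (separator y∈ z∈ cly (y≢z ∘ sym) y≁z) (y≢z ∘ sym) y≁z
                w∈X , yw = ∧-true⁻ {X w} w∈
            in w , ∧-true⁺ w∈X (cly (∧-true⁺ u∈ (Adj-sym {H = G} uy)) (NX⇒NU w∈) (≢-source uz w≁z))
                 , ≢-target yw y≁z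
                 , ¬true⇒false λ a → true≢false (Adj-sym {H = G} a) w≁z
    y = proj₁ outside-X
    y∈N : InV (N X u) y
    y∈N = proj₁ (proj₂ outside-X)
    y≢z = proj₁ (proj₂ (proj₂ outside-X))
    z≁y : adj G z y ≡ false
    z≁y = proj₂ (proj₂ (proj₂ outside-X))
    uy : Adj G u y
    uy = proj₂ (∧-true⁻ {X y} y∈N)
    y∈ : InV U y
    y∈ = proj₁ (X⁻ (proj₁ (∧-true⁻ y∈N)))
    k≤ : k ≤ count (N X z)
    k≤ = separator z∈ y∈ clz y≢z z≁y
    zu : Adj G z u
    zu = Adj-sym {H = G} uz
    toNX : ∀ w → InV (N X z) w → w ≢ u → InV (N X u) w
    toNX w p w≢u = ∧-true⁺ (proj₁ (∧-true⁻ p)) (clz (∧-true⁺ u∈ zu) (NX⇒NU p) (w≢u ∘ sym))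
    NXz≢y : ∀ {w} → InV (N X z) w → w ≢ y
    NXz≢y {w} p = ≢-target (proj₂ (∧-true⁻ {X w} p)) z≁y
    pair : NonAdjacentPair (N X u)
    -- The vertex `w` differs from `u` because `u` is adjacent to `y` and `w` is not.
    pair = let w , p , w≁y = missed clz k≤ y≢z z≁y
           in w , y , toNX w p (≢-source uy w≁y ∘ sym) , y∈N , NXz≢y p , w≁y
    large : k ≤ count (N X u)
    large = begin
      k                       ≤⟨ k≤ ⟩
      count (N X z)           ≡⟨ count-∖ (N X z) u (∧-true⁺ u∈X zu) ⟩
      suc (count (N X z ∖ u)) ≤⟨ s≤s (count-mono λ w p → let a , b = ∖-true⁻ (N X z) u p in ∖-true⁺ (N X u) y (toNX w a b) (NXz≢y a)) ⟩
      suc (count (N X u ∖ y)) ≡⟨ sym (count-∖ (N X u) y y∈N) ⟩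
      count (N X u)           ∎
      where open ≤-Reasoning

  X-empty : ∀ u → X u ≡ false
  X-empty u = ¬true⇒false λ p → no-flawed-core X (≤-trans (s≤s z≤n) (≤-reflexive (sym (count-∖ X u p)))) core

  -- With `X` empty, every neighbourhood is a clique, so no edge leaves the closed neighbourhood of
  -- `x`. Connectivity, taken with no vertex removed, puts `y` into it.
  complete : ∀ {x y} → InV U x → InV U y → x ≢ y → Adj G x y
  complete {x} {y} x∈ y∈ x≢y =
    end (spread (inj₁ refl) (proj₂ conn (λ _ → false) (λ (_ , _ , h) → no-vertex (h zero)) x y x∈ refl y∈ refl))
    where
    no-vertex : ¬ (false ≡ true)
    no-vertex ()
    Near : Fin n → Set
    Near w = w ≡ x ⊎ Adj G x w
    end : Near y → Adj G x y
    end (inj₁ p) = ⊥-elim (x≢y (sym p))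
    end (inj₂ p) = p
    next : ∀ {w w′} → Near w → InV U w → InV U w′ → Adj G w w′ → Near w′
    next (inj₁ refl) _ _ a = inj₂ a
    next {w} {w′} (inj₂ xw) w∈ w′∈ a with w′ ≟ x
    ... | yes p = inj₁ p
    ... | no w′≢x = inj₂ (∉X⇒clique w∈ (X-empty w) (∧-true⁺ x∈ (Adj-sym {H = G} xw)) (∧-true⁺ w′∈ a) (w′≢x ∘ sym))
    spread : ∀ {w} → Near w → Reach E (λ u → U u ≡ true × false ≡ false) w y → Near y
    spread nw (here _) = nw
    spread nw (step e e∈ j (p , _) r) = spread (next nw p (proj₁ (Reach-start r)) (E⇒Adj e e∈ j)) r

  rigid : RigidSub M U E
  rigid e = mk⇔ (G⊆KU e) λ (p , q) → adj-edge⁻ {H = G} e (complete p q (lo≢hi e)) (Joins-lo-hi e)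

theorem6p2 : ∀ {n : ℕ} (d : ℕ) → 1 ≤ d → (M : Matroid n) →
    IsAbstractRigidity d M → OneExtendable d M →
    (U : VSet n) (E : ESet n) → Subgraph U E →
    KConnected (d * suc d) U E → RigidSub M U E
theorem6p2 (suc c) (s≤s z≤n) M ar ext U E sub conn = Connected.rigid c M ar ext U E sub conn
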